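{- For $2\le t\le 5$, $R^4(BK_t,BK_t)=t+2$, and for every integer $t\ge 6$, $R^4(BK_t,BK_t)=t+1$.
   Context: For a graph $G=(V,E)$ and an integer $r\ge 2$, $BG$ (the set of Berge copies of $G$) is the set of $r$-uniform hypergraphs $\mathcal{H}'$ for which there exist an injection $\phi: V\to V(\mathcal{H}')$ and a bijection $\psi: E\to E(\mathcal{H}')$ such that $\{\phi(u),\phi(v)\}\subseteq \psi(uv)$ for every edge $uv\in E$. $K_n$ denotes the complete graph on $n$ vertices. For collections $\mathcal{F}_1,\mathcal{F}_2$ of $r$-uniform hypergraphs, $R^r(\mathcal{F}_1,\mathcal{F}_2)$ is the least $N$ such that every 2-coloring of the hyperedges of the complete $r$-uniform hypergraph on $N$ vertices contains a subhypergraph of the first color isomorphic to a member of $\mathcal{F}_1$ or one of the second color isomorphic to a member of $\mathcal{F}_2$. Here $r=4$. -}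

module Defs where

open import Data.Nat using (ℕ; _<_; _+_; _≤_)
open import Data.Fin using (Fin) renaming (_<_ to _<ᶠ_)
open import Data.Fin.Subset using (Subset; _∈_; ∣_∣)
open import Data.Bool using (Bool; true; false)
open import Data.Product using (Σ; _×_; ∃; ∃-syntax)
open import Data.Sum using (_⊎_)
open import Relation.Nullary using (¬_)
open import Relation.Binary.PropositionalEquality using (_≡_)
open import Function.Definitions using (Injective)

r : ℕ
r = 4

-- The complete r-uniform hypergraph on vertex set Fin N has as hyperedges
-- exactly the subsets of Fin N of cardinality r.  A 2-colouring assigns a
-- colour (Bool) to each subset; only its values on r-subsets matter.
Colouring : ℕ → Set
Colouring N = Subset N → Bool

-- The colouring c contains, in colour col, a Berge copy of K_t:
-- an injection φ of the vertices of K_t into Fin N, and an injective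
-- assignment ψ of a hyperedge (an r-subset of colour col) to every edge
-- {i,j} (i < j) of K_t, such that φ i, φ j ∈ ψ i j.
-- (The image of ψ is the sub-hypergraph; ψ is a bijection onto it.)
HasBergeK : (t N : ℕ) → Colouring N → Bool → Set
HasBergeK t N c col =
  Σ (Fin t → Fin N) λ φ →
  Σ (Fin t → Fin t → Subset N) λ ψ →
    Injective _≡_ _≡_ φ
    × (∀ i j → i <ᶠ j → ∣ ψ i j ∣ ≡ r × c (ψ i j) ≡ col × φ i ∈ ψ i j × φ j ∈ ψ i j)
    × (∀ i j k l → i <ᶠ j → k <ᶠ l → ψ i j ≡ ψ k l → (i ≡ k × j ≡ l))

Arrows : (t N : ℕ) → Set
Arrows t N = ∀ (c : Colouring N) → HasBergeK t N c true ⊎ HasBergeK t N c false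

RamseyBK4≡ : (t N : ℕ) → Set
RamseyBK4≡ t N = Arrows t N × (∀ M → M < N → ¬ Arrows t M)

{-# OPTIONS --safe #-}
module Submission where

-- Upper bound.  By Hall's theorem, if a colour has no Berge copy of K_t on a given set of t vertices, then some
-- graph A on these vertices is deficient: fewer than |A| of the 4-sets of this colour contain an edge of A.
-- For n = t + 1 and t ≥ 6, a deficient star with centre v can be united with a deficient graph on the vertices
-- other than v, so if no copy exists at all there is a deficient A that is not a star.  If both colours fail
-- this gives non-stars A and B such that at most |A| + |B| - 2 sets of size 4 contain an edge of both,
-- whereas there are always at least |A| + |B| - 1 of them.  This last claim is shown by induction on n:
-- a vertex x outside a 2K₂ or K₃ of A and one of B lies on at least deg_A x + deg_B x such 4-sets, and for n = 7
-- all but at most 18 - |A| of the 35 four-sets contain an edge of A.  The cases t ≤ 4 use the same count for n = t + 2,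
-- and t = 5 follows from t = 6.
-- Lower bound.  Colour a 4-set by whether it contains both 0 and 1.  On t vertices one colour does not cover
-- the pair 01 and the other has only (t-2 choose 2) 4-sets; for t ≤ 5 each colour has too few 4-sets on t + 1 vertices.

open import Defs
open import Data.Bool.Base using (Bool; true; false; _∧_; _∨_; not; if_then_else_)
open import Data.Bool.ListAction using (any; all)
open import Data.Bool.Properties using (T-≡) renaming (_≟_ to _≟ᵇ_)
open import Data.Empty using (⊥; ⊥-elim)
open import Data.Fin.Base using (Fin; zero; suc; punchIn; punchOut) renaming (_<_ to _<ᶠ_)
import Data.Fin.Properties as Fin
open import Data.Fin.Properties using () renaming (_≟_ to _≟ᶠ_)
open import Data.Fin.Subset using (Subset; inside; outside; ∣_∣) renaming (_∈_ to _∈ˢ_; ⊥ to ∅)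
open import Data.Fin.Subset.Properties using () renaming (_∈?_ to _∈ˢ?_)
open import Data.List.Base using (List; []; _∷_; _++_; length; map; filterᵇ; foldr; upTo; applyUpTo; tabulate; allFin)
import Data.List.Membership.DecPropositional as DecMembership
open import Data.List.Membership.Propositional using (_∈_; _∉_; find)
open import Data.List.Membership.Propositional.Properties using (∈-∃++; ∈-++⁺ˡ; ∈-++⁺ʳ; ∈-++⁻; ∈-map⁺; ∈-map⁻; ∈-tabulate⁺; ∈-tabulate⁻; ∈-allFin; ∈-filter⁺)
import Data.List.Properties as List
open import Data.List.Relation.Binary.Permutation.Propositional using (_↭_; refl; prep; swap; trans; ↭-sym; ↭-trans; ↭⇒↭ₛ)
open import Data.List.Relation.Binary.Permutation.Propositional.Properties using (∈-resp-↭; shift; shifts; ↭-length; ++-comm)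
open import Data.List.Relation.Binary.Permutation.Setoid.Properties using (Unique-resp-↭)
open import Data.List.Relation.Binary.Subset.Propositional using (_⊆_)
open import Data.List.Relation.Binary.Subset.Propositional.Properties as Subset using (∷⁺ʳ; xs⊆xs++ys; xs⊆ys++xs)
open import Data.List.Relation.Unary.All as All using (All; []; _∷_; lookup; all?)
import Data.List.Relation.Unary.All.Properties as All
open import Data.List.Relation.Unary.AllPairs as AllPairs using (AllPairs; []; _∷_)
open import Data.List.Relation.Unary.AllPairs.Properties using (tabulate⁺-<)
open import Data.List.Relation.Unary.Any using (here; there)
open import Data.List.Relation.Unary.Unique.Propositional using (Unique)
open import Data.List.Relation.Unary.Unique.Propositional.Properties using (map⁺; ++⁺; tabulate⁺; allFin⁺)
open import Data.Maybe.Base using (Maybe; just; nothing)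
open import Data.Nat.Base using (ℕ; zero; suc; _+_; _*_; _∸_; _≤_; _<_; z≤n; s≤s; s≤s⁻¹; _⊓_; _⊔_; _≡ᵇ_; _≤ᵇ_)
open import Data.Nat.Properties hiding (_≟_)
import Data.Nat.Properties as ℕ
open import Algebra.Properties.CommutativeSemigroup +-commutativeSemigroup using (interchange; x∙yz≈y∙xz)
open import Data.Nat.Tactic.RingSolver using (solve-∀)
open import Data.Product using (Σ; ∃; ∃-syntax; _×_; _,_; proj₁; proj₂; uncurry)
import Data.Product.Properties as Product
open import Data.Sum using (_⊎_; inj₁; inj₂; [_,_]′)
open import Data.Vec.Base using ([]; _∷_; _[_]≔_; here; there)
open import Data.Vec.Properties using ([]≔-updates; []≔-minimal; ∷-injectiveʳ)
open import Function using (_∘_; const; case_of_)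
open import Function.Bundles using (Equivalence)
open import Function.Definitions using (Injective)
open import Relation.Binary.Definitions using (DecidableEquality; tri<; tri≈; tri>)
open import Relation.Binary.PropositionalEquality using (_≡_; _≢_; refl; sym; cong; cong₂; subst; setoid; ≢-sym; module ≡-Reasoning) renaming (trans to ≡-trans)
open import Relation.Nullary using (¬_; Dec; yes; no; does)
open import Relation.Nullary.Decidable using (_×-dec_; ¬?; T?; dec-true; from-yes)

-- Stars are the obstacle. On n vertices let A be a star with n - 2 edges and B a single edge pq
-- avoiding its centre z. A 4-set containing an edge of both consists of p, q, z and one more
-- vertex, so there are at most n - 3 of them, fewer than |A| + |B| - 1 = n - 2. A non-star contains
-- 2K₂ or K₃, and the further edges supply the missing sets. The constant 18 comes from 18 + 18 = 35
-- + 1: two bounds 18 - |A| and 18 - |B| on the avoided 4-sets add up to exactly the claim. In the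
-- same way 8, 3 and 1 belong to the 15, 5 and 1 four-sets on six, five and four vertices. The claim
-- is false for two complete graphs on seven vertices, since 21 + 21 - 1 exceeds 35. Hence t = 6
-- relies on a bound on the number of edges, and the induction starts at n = 8, where graphs with at
-- least 19 edges on seven of the vertices are treated separately. For n = 8 two disjoint copies of
-- 2K₂ may use up all vertices. Then an edge leaving its copy allows an exchange that frees a
-- vertex; without such an edge A and B live on complementary sets, and each union of an edge of A
-- with an edge of B is a common 4-set.

private variable
  V : Set

-- Booleans and their indicator values

ι : Bool → ℕ
ι true  = 1
ι false = 0

ι-mono : ∀ {b c} → (b ≡ true → c ≡ true) → ι b ≤ ι c
ι-mono {false} f = z≤n
ι-mono {true}  f rewrite f refl = ≤-refl

ι≤1 : ∀ b → ι b ≤ 1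
ι≤1 false = z≤n
ι≤1 true  = ≤-refl

bool-ext : ∀ {b c : Bool} → (b ≡ true → c ≡ true) → (c ≡ true → b ≡ true) → b ≡ c
bool-ext {true}          f g = sym (f refl)
bool-ext {false} {true}  f g = g refl
bool-ext {false} {false} f g = refl

∨-true : ∀ {b c} → b ∨ c ≡ true → b ≡ true ⊎ c ≡ true
∨-true {true}  _ = inj₁ refl
∨-true {false} e = inj₂ e

∨-introˡ : ∀ {b c} → b ≡ true → b ∨ c ≡ true
∨-introˡ refl = refl

∨-introʳ : ∀ {b c} → c ≡ true → b ∨ c ≡ true
∨-introʳ {true}  _ = refl
∨-introʳ {false} e = e

∧-true : ∀ {b c} → b ∧ c ≡ true → b ≡ true × c ≡ true
∧-true {true} e = refl , e

∧-intro : ∀ {b c} → b ≡ true → c ≡ true → b ∧ c ≡ true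
∧-intro refl e = e

true? : ∀ b → b ≡ true ⊎ b ≡ false
true? true  = inj₁ refl
true? false = inj₂ refl

any-true : ∀ (p : V → Bool) {xs} → any p xs ≡ true → ∃[ x ] x ∈ xs × p x ≡ true
any-true p {x ∷ xs} e with ∨-true {p x} e
... | inj₁ px = x , here refl , px
... | inj₂ q  = let y , y∈ , py = any-true p q in y , there y∈ , py

any-intro : ∀ (p : V → Bool) {xs x} → x ∈ xs → p x ≡ true → any p xs ≡ true
any-intro p (here refl) e = ∨-introˡ e
any-intro p {y ∷ _} (there i) e = ∨-introʳ {p y} (any-intro p i e)

any? : ∀ (p : V → Bool) xs → (∃[ x ] x ∈ xs × p x ≡ true) ⊎ (∀ {x} → x ∈ xs → p x ≡ false)
any? p [] = inj₂ λ ()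
any? p (x ∷ xs) with true? (p x) | any? p xs
... | inj₁ e | _ = inj₁ (x , here refl , e)
... | inj₂ e | inj₁ (y , i , e′) = inj₁ (y , there i , e′)
... | inj₂ e | inj₂ h = inj₂ λ { (here refl) → e ; (there i) → h i }

-- Sums over the k-element sublists of a list

∑ : ℕ → (List V → ℕ) → List V → ℕ
∑ zero    f xs       = f []
∑ (suc k) f []       = 0
∑ (suc k) f (x ∷ xs) = ∑ k (f ∘ (x ∷_)) xs + ∑ (suc k) f xs

∑-mono-length : ∀ k {f g : List V → ℕ} xs → (∀ l → length l ≡ k → f l ≤ g l) → ∑ k f xs ≤ ∑ k g xs
∑-mono-length zero    xs       h = h [] refl
∑-mono-length (suc k) []       h = z≤n
∑-mono-length (suc k) (x ∷ xs) h =
  +-mono-≤ (∑-mono-length k xs λ l e → h (x ∷ l) (cong suc e)) (∑-mono-length (suc k) xs h)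

∑-mono : ∀ k {f g : List V → ℕ} xs → (∀ l → f l ≤ g l) → ∑ k f xs ≤ ∑ k g xs
∑-mono k xs h = ∑-mono-length k xs λ l _ → h l

∑-cong : ∀ k {f g : List V → ℕ} xs → (∀ l → f l ≡ g l) → ∑ k f xs ≡ ∑ k g xs
∑-cong k xs h = ≤-antisym (∑-mono k xs (≤-reflexive ∘ h)) (∑-mono k xs (≤-reflexive ∘ sym ∘ h))

∑-+ : ∀ k (f g : List V → ℕ) xs → ∑ k (λ l → f l + g l) xs ≡ ∑ k f xs + ∑ k g xs
∑-+ zero    f g xs       = refl
∑-+ (suc k) f g []       = refl
∑-+ (suc k) f g (x ∷ xs)
  rewrite ∑-+ k (f ∘ (x ∷_)) (g ∘ (x ∷_)) xs | ∑-+ (suc k) f g xs =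
  interchange (∑ k (f ∘ (x ∷_)) xs) (∑ k (g ∘ (x ∷_)) xs) _ _

∑-*ʳ : ∀ k (f : List V → ℕ) c xs → ∑ k (λ l → f l * c) xs ≡ ∑ k f xs * c
∑-*ʳ zero    f c xs       = refl
∑-*ʳ (suc k) f c []       = refl
∑-*ʳ (suc k) f c (x ∷ xs) rewrite ∑-*ʳ k (f ∘ (x ∷_)) c xs | ∑-*ʳ (suc k) f c xs =
  sym (*-distribʳ-+ c (∑ k (f ∘ (x ∷_)) xs) _)

∑-*ˡ : ∀ k (f : List V → ℕ) c xs → ∑ k (λ l → c * f l) xs ≡ c * ∑ k f xs
∑-*ˡ zero    f c xs       = refl
∑-*ˡ (suc k) f c []       = sym (*-zeroʳ c)
∑-*ˡ (suc k) f c (x ∷ xs) rewrite ∑-*ˡ k (f ∘ (x ∷_)) c xs | ∑-*ˡ (suc k) f c xs =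
  sym (*-distribˡ-+ c (∑ k (f ∘ (x ∷_)) xs) _)

∑-map : ∀ {W : Set} k (f : List V → ℕ) (h : W → V) xs → ∑ k f (map h xs) ≡ ∑ k (f ∘ map h) xs
∑-map zero    f h xs       = refl
∑-map (suc k) f h []       = refl
∑-map (suc k) f h (x ∷ xs) = cong₂ _+_ (∑-map k (f ∘ (h x ∷_)) h xs) (∑-map (suc k) f h xs)

Symmetric : (List V → ℕ) → Set
Symmetric f = ∀ {l l′} → l ↭ l′ → f l ≡ f l′

-- Sublists keep the order of the list, so `f` has to be symmetric. For a transposition the sublists
-- are split by which of `x` and `y` they contain.
∑-↭ : ∀ k {f : List V → ℕ} {xs ys} → Symmetric f → xs ↭ ys → ∑ k f xs ≡ ∑ k f ys
∑-↭ k s refl = refl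
∑-↭ k s (trans p q) = ≡-trans (∑-↭ k s p) (∑-↭ k s q)
∑-↭ zero s (prep x p) = refl
∑-↭ zero s (swap x y p) = refl
∑-↭ (suc k) s (prep x p) = cong₂ _+_ (∑-↭ k (s ∘ prep x) p) (∑-↭ (suc k) s p)
∑-↭ (suc zero) {f} s (swap x y p) rewrite ∑-↭ 1 s p = x∙yz≈y∙xz (f (x ∷ [])) (f (y ∷ [])) _
∑-↭ (suc (suc k)) {f} s (swap {xs} {ys} x y p) = begin
  (∑ k (f ∘ (x ∷_) ∘ (y ∷_)) xs + ∑ (suc k) (f ∘ (x ∷_)) xs) + (∑ (suc k) (f ∘ (y ∷_)) xs + ∑ (suc (suc k)) f xs)
    ≡⟨ cong₂ _+_ (cong₂ _+_ (≡-trans (∑-↭ k (s ∘ prep x ∘ prep y) p)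
                                     (∑-cong k ys λ l → s (swap x y refl)))
                            (∑-↭ (suc k) (s ∘ prep x) p))
                 (cong₂ _+_ (∑-↭ (suc k) (s ∘ prep y) p) (∑-↭ (suc (suc k)) s p)) ⟩
  (∑ k (f ∘ (y ∷_) ∘ (x ∷_)) ys + ∑ (suc k) (f ∘ (x ∷_)) ys) + (∑ (suc k) (f ∘ (y ∷_)) ys + ∑ (suc (suc k)) f ys)
    ≡⟨ interchange (∑ k (f ∘ (y ∷_) ∘ (x ∷_)) ys) _ _ _ ⟩
  _ ∎
  where open ≡-Reasoning

∑-≤-++ : ∀ k (f : List V → ℕ) xs ys → ∑ k f xs ≤ ∑ k f (xs ++ ys)
∑-≤-++ zero    f xs       ys = ≤-refl
∑-≤-++ (suc k) f []       ys = z≤n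
∑-≤-++ (suc k) f (x ∷ xs) ys = +-mono-≤ (∑-≤-++ k (f ∘ (x ∷_)) xs ys) (∑-≤-++ (suc k) f xs ys)

∑-≤-ʳ++ : ∀ k (f : List V → ℕ) xs ys → ∑ k f ys ≤ ∑ k f (xs ++ ys)
∑-≤-ʳ++ zero    f xs       ys = ≤-refl
∑-≤-ʳ++ (suc k) f []       ys = ≤-refl
∑-≤-ʳ++ (suc k) f (x ∷ xs) ys = ≤-trans (∑-≤-ʳ++ (suc k) f xs ys) (m≤n+m _ _)

-- A sublist of `xs` followed by one of `ys` determines both, so each pair on the left has a term of
-- its own on the right.
∑-∑-≤-++ : ∀ j k (f : List V → ℕ) xs ys →
           ∑ j (λ l → ∑ k (λ l′ → f (l ++ l′)) ys) xs ≤ ∑ (j + k) f (xs ++ ys)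
∑-∑-≤-++ zero    k f xs       ys = ∑-≤-ʳ++ k f xs ys
∑-∑-≤-++ (suc j) k f []       ys = z≤n
∑-∑-≤-++ (suc j) k f (x ∷ xs) ys =
  +-mono-≤ (∑-∑-≤-++ j k (f ∘ (x ∷_)) xs ys) (∑-∑-≤-++ (suc j) k f xs ys)

∑₁-pos : ∀ (f : List V → ℕ) xs → ∑ 1 f xs ≡ 0 ⊎ ∃[ x ] x ∈ xs × 0 < f (x ∷ [])
∑₁-pos f [] = inj₁ refl
∑₁-pos f (x ∷ xs) with f (x ∷ []) in eq | ∑₁-pos f xs
... | suc _ | _ = inj₂ (x , here refl , subst (0 <_) (sym eq) (s≤s z≤n))
... | zero  | inj₁ e = inj₁ e
... | zero  | inj₂ (y , i , p) = inj₂ (y , there i , p)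

∑₁-const : ∀ c (xs : List V) → ∑ 1 (const c) xs ≡ length xs * c
∑₁-const c []       = refl
∑₁-const c (x ∷ xs) = cong (c +_) (∑₁-const c xs)

∑-pos : ∀ k (f : List V → ℕ) xs → 0 < ∑ k f xs → ∃[ l ] l ⊆ xs × 0 < f l
∑-pos zero f xs p = [] , (λ ()) , p
∑-pos (suc k) f (x ∷ xs) p with ∑ k (f ∘ (x ∷_)) xs in eq
... | suc _ = let l , s , q = ∑-pos k (f ∘ (x ∷_)) xs (subst (0 <_) (sym eq) (s≤s z≤n))
              in x ∷ l , ∷⁺ʳ x s , q
... | zero  = let l , s , q = ∑-pos (suc k) f xs p in l , there ∘ s , q

-- Plays the part of a complement: with `∑-↭` any sum can be evaluated with the vertices of interest
-- in front.
extract : {cs xs : List V} → Unique cs → cs ⊆ xs → ∃[ ds ] xs ↭ cs ++ ds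
extract {cs = []}     {xs} _ _ = xs , refl
extract {cs = c ∷ cs} {xs} (c∉ ∷ u) s with ∈-∃++ (s (here refl))
... | as , bs , refl =
  let ds , p = extract {cs = cs} {as ++ bs} u
        (λ {x} i → case ∈-resp-↭ (shift c as bs) (s (there i)) of λ where
          (here refl) → ⊥-elim (lookup c∉ i refl)
          (there j)   → j)
  in ds , trans (shift c as bs) (prep c p)

unique-++ˡ : {xs ys : List V} → Unique (xs ++ ys) → Unique xs
unique-++ˡ {xs = []}     _       = []
unique-++ˡ {xs = x ∷ xs} (h ∷ u) = All.++⁻ˡ xs h ∷ unique-++ˡ u

unique-++-disjoint : {xs ys : List V} → Unique (xs ++ ys) → ∀ {x} → x ∈ xs → x ∉ ys
unique-++-disjoint {xs = x ∷ xs} (h ∷ _) (here refl) j = lookup h (∈-++⁺ʳ xs j) refl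
unique-++-disjoint {xs = x ∷ xs} (_ ∷ u) (there i)   j = unique-++-disjoint u i j

-- Hall's theorem

count : {X : Set} → (X → Bool) → List X → ℕ
count p []       = 0
count p (x ∷ xs) = ι (p x) + count p xs

count-mono : ∀ {X : Set} {p q : X → Bool} → (∀ x → p x ≡ true → q x ≡ true) → ∀ xs → count p xs ≤ count q xs
count-mono h []       = z≤n
count-mono h (x ∷ xs) = +-mono-≤ (ι-mono (h x)) (count-mono h xs)

count-mono₂ : ∀ {X : Set} {p q r s : X → Bool} → (∀ x → ι (p x) + ι (q x) ≤ ι (r x) + ι (s x)) →
              ∀ xs → count p xs + count q xs ≤ count r xs + count s xs
count-mono₂ h [] = z≤n
count-mono₂ {p = p} {q} {r} {s} h (x ∷ xs) = begin
  (ι (p x) + count p xs) + (ι (q x) + count q xs) ≡⟨ interchange (ι (p x)) _ _ _ ⟩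
  (ι (p x) + ι (q x)) + (count p xs + count q xs) ≤⟨ +-mono-≤ (h x) (count-mono₂ h xs) ⟩
  (ι (r x) + ι (s x)) + (count r xs + count s xs) ≡⟨ interchange (ι (r x)) _ _ _ ⟩
  (ι (r x) + count r xs) + (ι (s x) + count s xs) ∎
  where open ≤-Reasoning

count-pos : ∀ {X : Set} (p : X → Bool) {x xs} → x ∈ xs → p x ≡ true → 0 < count p xs
count-pos p (here refl) e rewrite e = s≤s z≤n
count-pos p {xs = y ∷ _} (there i) e = ≤-trans (count-pos p i e) (m≤n+m _ (ι (p y)))

module Hall {X Y : Set} (_≟_ : DecidableEquality X) (y₀ : Y) (adj : X → Y → Bool) (Xs : List X) where

  N : (X → Bool) → Y → Bool
  N A y = any (λ x → A x ∧ adj x y) Xs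

  record Matching (L : X → Bool) (R : List Y) : Set where
    constructor matching
    field
      partner   : X → Y
      partner-∈ : ∀ {x} → x ∈ Xs → L x ≡ true → partner x ∈ R
      adjacent  : ∀ {x} → x ∈ Xs → L x ≡ true → adj x (partner x) ≡ true
      injective : ∀ {x x′} → x ∈ Xs → x′ ∈ Xs → L x ≡ true → L x′ ≡ true → partner x ≡ partner x′ → x ≡ x′

  record Violator (L : X → Bool) (R : List Y) : Set where
    constructor violator
    field
      A         : X → Bool
      A⊆L       : ∀ {x} → A x ≡ true → L x ≡ true
      deficient : count (N A) R < count A Xs

  private
    _∪_ _∩_ : (X → Bool) → (X → Bool) → X → Bool
    (A ∪ B) x = A x ∨ B x
    (A ∩ B) x = A x ∧ B x

    _without_ : (X → Bool) → X → X → Bool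
    (L without z) x = L x ∧ not (does (x ≟ z))

    N-true : ∀ A {y} → N A y ≡ true → ∃[ x ] x ∈ Xs × A x ≡ true × adj x y ≡ true
    N-true A e = let x , i , e′ = any-true _ e in x , i , ∧-true e′

    N-intro : ∀ A {x y} → x ∈ Xs → A x ≡ true → adj x y ≡ true → N A y ≡ true
    N-intro A i a b = any-intro _ i (∧-intro a b)

    ι-submodular : ∀ {p q r s} → (p ≡ true → r ∨ s ≡ true) → (q ≡ true → r ∧ s ≡ true) → ι p + ι q ≤ ι r + ι s
    ι-submodular {p} {q} {true}  {true}  _ _ = +-mono-≤ (ι≤1 p) (ι≤1 q)
    ι-submodular {p} {true} {true} {false} _ h with () ← h refl
    ι-submodular {p} {false} {true} {false} _ _ = +-mono-≤ (ι≤1 p) z≤n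
    ι-submodular {p} {true} {false} {s} _ h with () ← h refl
    ι-submodular {true} {false} {false} {s} h _ rewrite h refl = ≤-refl
    ι-submodular {false} {false} {false} {s} _ _ = z≤n

    -- Neighbourhoods commute with unions, and the neighbourhood of an intersection lies in the
    -- intersection of the neighbourhoods.
    N-submodular : ∀ A B R → count (N (A ∪ B)) R + count (N (A ∩ B)) R ≤ count (N A) R + count (N B) R
    N-submodular A B = count-mono₂ λ y → ι-submodular {r = N A y} {N B y}
      (λ e → let x , i , a , b = N-true (A ∪ B) e in
        [ (λ a → ∨-introˡ (N-intro A i a b)) , (λ a → ∨-introʳ {N A y} (N-intro B i a b)) ]′ (∨-true a))
      (λ e → let x , i , a , b = N-true (A ∩ B) e
                 a₁ , a₂ = ∧-true a
             in ∧-intro (N-intro A i a₁ b) (N-intro B i a₂ b))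

    modular : ∀ A B → count A Xs + count B Xs ≤ count (A ∪ B) Xs + count (A ∩ B) Xs
    modular A B = count-mono₂ (λ x → pointwise (A x) (B x)) Xs
      where
      pointwise : ∀ a b → ι a + ι b ≤ ι (a ∨ b) + ι (a ∧ b)
      pointwise true  true  = ≤-refl
      pointwise true  false = ≤-refl
      pointwise false b     = m≤m+n (ι b) 0

    -- Uncrossing: on `R` the deficiencies of `A` and `B` add up to at least 2. The union is no
    -- longer deficient once `y` is added, so its deficiency on `R` is at most 1, and the rest falls
    -- to the intersection.
    ∩-deficient : ∀ A B y R → count (N A) R < count A Xs → count (N B) R < count B Xs →
                  ¬ (count (N (A ∪ B)) (y ∷ R) < count (A ∪ B) Xs) → count (N (A ∩ B)) R < count (A ∩ B) Xs
    ∩-deficient A B y R dA dB ¬d = +-cancelˡ-≤ (suc (count (N (A ∪ B)) R)) _ _ (begin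
      suc (count (N (A ∪ B)) R) + suc (count (N (A ∩ B)) R)
        ≡⟨ cong suc (+-suc _ _) ⟩
      2 + (count (N (A ∪ B)) R + count (N (A ∩ B)) R)
        ≤⟨ s≤s (s≤s (N-submodular A B R)) ⟩
      2 + (count (N A) R + count (N B) R)
        ≡⟨ cong suc (+-suc _ _) ⟨
      suc (count (N A) R) + suc (count (N B) R)
        ≤⟨ +-mono-≤ dA dB ⟩
      count A Xs + count B Xs
        ≤⟨ modular A B ⟩
      count (A ∪ B) Xs + count (A ∩ B) Xs
        ≤⟨ +-monoˡ-≤ _ (≮⇒≥ ¬d) ⟩
      count (N (A ∪ B)) (y ∷ R) + count (A ∩ B) Xs
        ≤⟨ +-monoˡ-≤ _ (+-monoˡ-≤ _ (ι≤1 (N (A ∪ B) y))) ⟩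
      suc (count (N (A ∪ B)) R) + count (A ∩ B) Xs ∎)
      where open ≤-Reasoning

    extend : ∀ {L R y z} → All (y ≢_) R → adj z y ≡ true → Matching (L without z) R → Matching L (y ∷ R)
    extend {L} {R} {y} {z} y∉R zy (matching f f∈ f-adj f-inj) = matching f′ f′∈ f′-adj f′-inj
      where
      f′ : X → Y
      f′ x with x ≟ z
      ... | yes _ = y
      ... | no  _ = f x
      L′ : ∀ {x} → x ≢ z → L x ≡ true → (L without z) x ≡ true
      L′ {x} n e with x ≟ z
      ... | yes p = ⊥-elim (n p)
      ... | no  _ = ∧-intro e refl
      f′∈ : ∀ {x} → x ∈ Xs → L x ≡ true → f′ x ∈ y ∷ R
      f′∈ {x} i e with x ≟ z
      ... | yes _ = here refl
      ... | no  n = there (f∈ i (L′ n e))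
      f′-adj : ∀ {x} → x ∈ Xs → L x ≡ true → adj x (f′ x) ≡ true
      f′-adj {x} i e with x ≟ z
      ... | yes refl = zy
      ... | no  n    = f-adj i (L′ n e)
      f′-inj : ∀ {x x′} → x ∈ Xs → x′ ∈ Xs → L x ≡ true → L x′ ≡ true → f′ x ≡ f′ x′ → x ≡ x′
      f′-inj {x} {x′} i i′ e e′ q with x ≟ z | x′ ≟ z
      ... | yes refl | yes refl = refl
      ... | yes refl | no  n    = ⊥-elim (lookup y∉R (f∈ i′ (L′ n e′)) q)
      ... | no  n    | yes refl = ⊥-elim (lookup y∉R (f∈ i (L′ n e)) (sym q))
      ... | no  n    | no  n′   = f-inj i i′ (L′ n e) (L′ n′ e′) q

    -- A is intersected with violators until no neighbour of y is left in it.
    shrink : ∀ {L R y} → All (y ≢_) R → (∀ L → Matching L R ⊎ Violator L R) → (zs : List X) →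
             (V : Violator L R) → (∀ {x} → x ∈ Xs → Violator.A V x ≡ true → adj x y ≡ true → x ∈ zs) →
             Matching L (y ∷ R) ⊎ Violator L (y ∷ R)
    shrink {R = R} {y} _ _ [] (violator A A⊆L d) h =
      inj₂ (violator A A⊆L (subst (λ b → ι b + count (N A) R < count A Xs) (sym N-false) d))
      where
      N-false : N A y ≡ false
      N-false with true? (N A y)
      ... | inj₂ e = e
      ... | inj₁ e with x , i , a , b ← N-true A e with () ← h i a b
    shrink {L} {R} {y} y∉R rec (z ∷ zs) V@(violator A A⊆L d) h with true? (A z ∧ adj z y)
    ... | inj₂ no-edge = shrink y∉R rec zs V λ i a b → case h i a b of λ where
            (here refl) → case ≡-trans (sym no-edge) (∧-intro a b) of λ ()
            (there j)   → j
    -- Either `z` takes `y` and the rest of `L` is matched into `R`, or there is a violator `B`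
    -- missing `z`. In the latter case the union remains a violator after adding `y`, or the
    -- intersection is one for `R` and has lost the neighbour `z` of `y`.
    ... | inj₁ edge with rec (L without z)
    ...   | inj₁ M = inj₁ (extend y∉R (proj₂ (∧-true {A z} edge)) M)
    ...   | inj₂ (violator B B⊆L d′) with count (N (A ∪ B)) (y ∷ R) <? count (A ∪ B) Xs
    ...     | yes d″ = inj₂ (violator (A ∪ B) (λ e → [ A⊆L , proj₁ ∘ ∧-true ∘ B⊆L ]′ (∨-true e)) d″)
    ...     | no ¬d  = shrink y∉R rec zs
              (violator (A ∩ B) (λ {x} e → A⊆L (proj₁ (∧-true {A x} e))) (∩-deficient A B y R d d′ ¬d))
              λ {x} i a b → case h i (proj₁ (∧-true {A x} a)) b of λ where
                (here refl) → ⊥-elim (z∉ (proj₂ (∧-true {L x} (B⊆L (proj₂ (∧-true {A x} a))))))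
                (there j)   → j
      where
      z∉ : ¬ (not (does (z ≟ z)) ≡ true)
      z∉ e with z ≟ z
      z∉ () | yes _
      z∉ e  | no n = n refl

  -- Induction on the right-hand side for all `L` at once: a matching into `R` survives the arrival
  -- of `y`, so only a violator has to be repaired, and the repair calls the statement for `R` with
  -- smaller `L`.
  hall : ∀ {R} → Unique R → ∀ L → Matching L R ⊎ Violator L R
  hall [] L with any? L Xs
  ... | inj₁ (x , i , e) = inj₂ (violator L (λ e → e) (count-pos L i e))
  -- There is nothing to match; `y₀` is a default value that makes the partner function total.
  ... | inj₂ none = inj₁ (matching (const y₀) (λ i e → absurd i e) (λ i e → absurd i e) (λ i _ e → absurd i e))
    where
    absurd : ∀ {x} {P : Set} → x ∈ Xs → L x ≡ true → P
    absurd i e with () ← ≡-trans (sym e) (none i)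
  hall (y∉R ∷ u) L with hall u L
  ... | inj₁ (matching f f∈ f-adj f-inj) = inj₁ (matching f (λ i e → there (f∈ i e)) f-adj f-inj)
  ... | inj₂ V = shrink y∉R (hall u) Xs V λ i _ _ → i

-- Sets of pairs as graphs, and the 4-sets containing an edge

record Graph (V : Set) : Set where
  field
    adj    : V → V → Bool
    symm   : ∀ {x y} → adj x y ≡ true → adj y x ≡ true
    irrefl : ∀ {x} → ¬ (adj x x ≡ true)

open Graph

touch : Graph V → List V → Bool
touch G []      = false
touch G (x ∷ l) = any (adj G x) l ∨ touch G l

module _ (G : Graph V) where

  touch-true : ∀ {l} → touch G l ≡ true → ∃[ x ] ∃[ y ] x ∈ l × y ∈ l × adj G x y ≡ true
  touch-true {x ∷ l} e with ∨-true {any (adj G x) l} e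
  ... | inj₁ p = let y , i , q = any-true _ p in x , y , here refl , there i , q
  ... | inj₂ p = let y , z , i , j , q = touch-true p in y , z , there i , there j , q

  touch-intro : ∀ l {x y} → x ∈ l → y ∈ l → adj G x y ≡ true → touch G l ≡ true
  touch-intro (x ∷ l) (here refl) (here refl) e = ⊥-elim (irrefl G e)
  touch-intro (x ∷ l) (here refl) (there j)   e = ∨-introˡ (any-intro _ j e)
  touch-intro (x ∷ l) (there i)   (here refl) e = ∨-introˡ (any-intro _ i (symm G e))
  touch-intro (x ∷ l) (there i)   (there j)   e = ∨-introʳ {any (adj G x) l} (touch-intro l i j e)

  edge-touches : ∀ {x y} → adj G x y ≡ true → touch G (x ∷ y ∷ []) ≡ true
  edge-touches {x} {y} = touch-intro (x ∷ y ∷ []) (here refl) (there (here refl))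

  touch-⊆ : ∀ l l′ → l ⊆ l′ → touch G l ≡ true → touch G l′ ≡ true
  touch-⊆ l l′ s e = let x , y , i , j , q = touch-true e in touch-intro l′ (s i) (s j) q

  touch-↭ : ∀ {l l′} → l ↭ l′ → touch G l ≡ touch G l′
  touch-↭ {l} {l′} p = bool-ext (touch-⊆ l l′ (∈-resp-↭ p)) (touch-⊆ l′ l (∈-resp-↭ (↭-sym p)))

  size : List V → ℕ
  size = ∑ 2 (λ l → ι (touch G l))

  untouched : ℕ → List V → ℕ
  untouched k = ∑ k (λ l → ι (not (touch G l)))

-- Bounding the avoided sets by a finite search

sublists : ℕ → List V → List (List V)
sublists zero    xs       = [] ∷ []
sublists (suc k) []       = []
sublists (suc k) (x ∷ xs) = map (x ∷_) (sublists k xs) ++ sublists (suc k) xs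

count-map : ∀ {X Y : Set} (p : Y → Bool) (h : X → Y) xs → count p (map h xs) ≡ count (p ∘ h) xs
count-map p h []       = refl
count-map p h (x ∷ xs) = cong (ι (p (h x)) +_) (count-map p h xs)

count-++ : ∀ {X : Set} (p : X → Bool) xs ys → count p (xs ++ ys) ≡ count p xs + count p ys
count-++ p []       ys = refl
count-++ p (x ∷ xs) ys rewrite count-++ p xs ys = sym (+-assoc (ι (p x)) _ _)

∑-count : ∀ k (p : List V → Bool) xs → ∑ k (ι ∘ p) xs ≡ count p (sublists k xs)
∑-count zero    p xs = sym (+-identityʳ _)
∑-count (suc k) p [] = refl
∑-count (suc k) p (x ∷ xs)
  rewrite count-++ p (map (x ∷_) (sublists k xs)) (sublists (suc k) xs) | count-map p (x ∷_) (sublists k xs)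
  = cong₂ _+_ (∑-count k (p ∘ (x ∷_)) xs) (∑-count (suc k) p xs)

count≤length : ∀ {X : Set} (p : X → Bool) xs → count p xs ≤ length xs
count≤length p []       = z≤n
count≤length p (x ∷ xs) = +-mono-≤ (ι≤1 (p x)) (count≤length p xs)

≤ᵇ-sound : ∀ m n → (m ≤ᵇ n) ≡ true → m ≤ n
≤ᵇ-sound m n e = ≤ᵇ⇒≤ m n (Equivalence.from T-≡ e)

within : List ℕ → List ℕ → Bool
within e q = all (λ i → any (i ≡ᵇ_) q) e

within-⊆ : ∀ e {q} → within e q ≡ true → e ⊆ q
within-⊆ (i ∷ e) {q} h x∈ with ∧-true {any (i ≡ᵇ_) q} h | x∈
... | a , _ | here refl = let j , j∈ , p = any-true (i ≡ᵇ_) a in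
                          subst (_∈ q) (sym (≡ᵇ⇒≡ i j (Equivalence.from T-≡ p))) j∈
... | _ , b | there x∈′ = within-⊆ e b x∈′

-- Decides whether, for every edge set agreeing with hints, at most h (number of edges) members of qs
-- contain no edge; k edges are already chosen, qs has been thinned accordingly and es is undecided.
-- A branch is cut as soon as the bound holds even if all the edges of es are chosen.
module Search (h : ℕ → ℕ) (hints : List (List ℕ × Bool)) where

  lookupHint : List (List ℕ × Bool) → List ℕ → Maybe Bool
  lookupHint []             e = nothing
  lookupHint ((e′ , b) ∷ H) e = if does (List.≡-dec ℕ._≟_ e′ e) then just b else lookupHint H e

  hint : List ℕ → Maybe Bool
  hint = lookupHint hints

  search : List (List ℕ) → List (List ℕ) → ℕ → Bool
  branch : Maybe Bool → List ℕ → List (List ℕ) → List (List ℕ) → ℕ → Bool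

  search []       qs k = length qs ≤ᵇ h k
  search (e ∷ es) qs k = (length qs ≤ᵇ h (k + suc (length es))) ∨ branch (hint e) e es qs k

  branch (just true)  e es qs k = search es (filterᵇ (not ∘ within e) qs) (suc k)
  branch (just false) e es qs k = search es qs k
  branch nothing      e es qs k = search es qs k ∧ search es (filterᵇ (not ∘ within e) qs) (suc k)

  module Sound (antitone : ∀ {a b} → a ≤ b → h b ≤ h a) (A : List ℕ → Bool)
               (agrees : ∀ e {b} → hint e ≡ just b → A e ≡ b) where

    avoids : List (List ℕ) → List ℕ → Bool
    avoids es q = not (any (λ e → A e ∧ within e q) es)

    private
      thinned : ∀ (p r : List ℕ → Bool) qs → count (λ q → not (p q ∨ r q)) qs ≤ count (not ∘ r) (filterᵇ (not ∘ p) qs)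
      thinned p r [] = z≤n
      thinned p r (q ∷ qs) with p q
      ... | true  = thinned p r qs
      ... | false = +-monoʳ-≤ _ (thinned p r qs)

      chosen : ∀ e es qs → A e ≡ true → count (avoids (e ∷ es)) qs ≤ count (avoids es) (filterᵇ (not ∘ within e) qs)
      chosen e es qs a rewrite a = thinned (within e) (λ q → any (λ e → A e ∧ within e q) es) qs

    sound : ∀ es qs k → search es qs k ≡ true → count (avoids es) qs ≤ h (k + count A es)
    sound-in : ∀ e es qs k → A e ≡ true → search es (filterᵇ (not ∘ within e) qs) (suc k) ≡ true →
               count (avoids (e ∷ es)) qs ≤ h (k + count A (e ∷ es))
    sound-out : ∀ e es qs k → A e ≡ false → search es qs k ≡ true →
                count (avoids (e ∷ es)) qs ≤ h (k + count A (e ∷ es))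

    sound [] qs k s rewrite +-identityʳ k = ≤-trans (count≤length _ qs) (≤ᵇ-sound _ _ s)
    sound (e ∷ es) qs k s with ∨-true {length qs ≤ᵇ h (k + suc (length es))} s
    ... | inj₁ cut = ≤-trans (count≤length _ qs) (≤-trans (≤ᵇ-sound _ _ cut)
                       (antitone (+-monoʳ-≤ k (count≤length A (e ∷ es)))))
    ... | inj₂ b with hint e in eq
    ...   | just true  = sound-in e es qs k (agrees e eq) b
    ...   | just false = sound-out e es qs k (agrees e eq) b
    ...   | nothing with true? (A e)
    ...     | inj₁ a = sound-in e es qs k a (proj₂ (∧-true {search es qs k} b))
    ...     | inj₂ a = sound-out e es qs k a (proj₁ (∧-true {search es qs k} b))

    sound-in e es qs k a s = begin
      count (avoids (e ∷ es)) qs                         ≤⟨ chosen e es qs a ⟩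
      count (avoids es) (filterᵇ (not ∘ within e) qs)    ≤⟨ sound es _ (suc k) s ⟩
      h (suc k + count A es)                             ≡⟨ cong h (+-suc k (count A es)) ⟨
      h (k + suc (count A es))                           ≡⟨ cong (λ b → h (k + (ι b + count A es))) a ⟨
      h (k + count A (e ∷ es))                           ∎
      where open ≤-Reasoning

    sound-out e es qs k a s rewrite a = sound es qs k s

  -- The search evaluates on lists of indices, independently of `V` and `G`; `∑-map` carries the
  -- counts over to the vertices. An edge inside an index list stays inside its image under `at`, by
  -- `touch-⊆`.
  untouched-bound : (∀ {a b} → a ≤ b → h b ≤ h a) → (G : Graph V) (at : ℕ → V) →
                    All (λ (e , b) → touch G (map at e) ≡ b) hints →
                    ∀ j is → search (sublists 2 is) (sublists j is) 0 ≡ true →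
                    untouched G j (map at is) ≤ h (size G (map at is))
  untouched-bound antitone G at agree j is s = begin
    untouched G j (map at is)                                  ≡⟨ ∑-map j _ at is ⟩
    ∑ j (λ l → ι (not (touch G (map at l)))) is                ≡⟨ ∑-count j _ is ⟩
    count (λ l → not (touch G (map at l))) (sublists j is)     ≤⟨ count-mono avoided (sublists j is) ⟩
    count (avoids (sublists 2 is)) (sublists j is)             ≤⟨ sound (sublists 2 is) (sublists j is) 0 s ⟩
    h (count (λ l → touch G (map at l)) (sublists 2 is))       ≡⟨ cong h (∑-count 2 _ is) ⟨
    h (∑ 2 (λ l → ι (touch G (map at l))) is)                  ≡⟨ cong h (∑-map 2 _ at is) ⟨
    h (size G (map at is))                                     ∎
    where
    open ≤-Reasoning
    agrees : ∀ H → All (λ (e , b) → touch G (map at e) ≡ b) H →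
             ∀ e {b} → lookupHint H e ≡ just b → touch G (map at e) ≡ b
    agrees ((e′ , b) ∷ H) (p ∷ ps) e eq with List.≡-dec ℕ._≟_ e′ e
    agrees ((e′ , b) ∷ H) (p ∷ ps) e refl | yes refl = p
    ... | no _ = agrees H ps e eq
    open Sound antitone (λ l → touch G (map at l)) (agrees hints agree)
    avoided : ∀ l → not (touch G (map at l)) ≡ true → avoids (sublists 2 is) l ≡ true
    avoided l e with true? (any (λ e → touch G (map at e) ∧ within e l) (sublists 2 is))
    ... | inj₂ f = cong not f
    ... | inj₁ t with e′ , _ , p ← any-true (λ e → touch G (map at e) ∧ within e l) {sublists 2 is} t
                 with a , b ← ∧-true {touch G (map at e′)} p
                 with () ← ≡-trans (sym e) (cong not (touch-⊆ G (map at e′) (map at l) (Subset.map⁺ at (within-⊆ e′ {l} b)) a))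

-- Non-stars on six and seven vertices

data Core (G : Graph V) : List V → Set where
  2K₂ : ∀ {u v u′ v′} → adj G u v ≡ true → adj G u′ v′ ≡ true → Core G (u ∷ v ∷ u′ ∷ v′ ∷ [])
  K₃  : ∀ {u v w} → adj G u v ≡ true → adj G u w ≡ true → adj G v w ≡ true → Core G (u ∷ v ∷ w ∷ [])

-- Equivalently (see nonStar⊎star), G has an edge and no vertex lies on all of its edges.
record NonStar (G : Graph V) (xs : List V) : Set where
  constructor nonStar
  field
    {vertices} : List V
    unique     : Unique vertices
    included   : vertices ⊆ xs
    core       : Core G vertices

open NonStar

Symmetric-touch : (G : Graph V) → Symmetric (λ l → ι (touch G l))
Symmetric-touch G p = cong ι (touch-↭ G p)

Symmetric-untouched : (G : Graph V) → Symmetric (λ l → ι (not (touch G l)))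
Symmetric-untouched G p = cong (ι ∘ not) (touch-↭ G p)

nth : V → List V → ℕ → V
nth d []       _       = d
nth d (x ∷ xs) zero    = x
nth d (x ∷ xs) (suc i) = nth d xs i

map-nth : ∀ (d : V) xs → map (nth d xs) (upTo (length xs)) ≡ xs
map-nth d xs = ≡-trans (List.map-applyUpTo (λ i → i) (nth d xs) (length xs)) (applyUpTo-nth xs)
  where
  applyUpTo-nth : ∀ xs → applyUpTo (nth d xs) (length xs) ≡ xs
  applyUpTo-nth []       = refl
  applyUpTo-nth (x ∷ xs) = cong (x ∷_) (applyUpTo-nth xs)

-- The edges of the core, at the positions they have once `extract` has moved its vertices to the
-- front.
hints-2K₂ hints-K₃ : List (List ℕ × Bool)
hints-2K₂ = (0 ∷ 1 ∷ [] , true) ∷ (2 ∷ 3 ∷ [] , true) ∷ []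
hints-K₃  = (0 ∷ 1 ∷ [] , true) ∷ (0 ∷ 2 ∷ [] , true) ∷ (1 ∷ 2 ∷ [] , true) ∷ []

module _ (h : ℕ → ℕ) (antitone : ∀ {a b} → a ≤ b → h b ≤ h a) (G : Graph V) where

  hinted-untouched : ∀ H j n {xs zs} (d : V) → xs ↭ zs → length xs ≡ n → All (λ (e , b) → touch G (map (nth d zs) e) ≡ b) H →
    Search.search h H (sublists 2 (upTo n)) (sublists j (upTo n)) 0 ≡ true → untouched G j xs ≤ h (size G xs)
  hinted-untouched H j n {zs = zs} d p refl hs s
    rewrite ∑-↭ j (Symmetric-untouched G) p | ∑-↭ 2 (Symmetric-touch G) p | ↭-length p =
    subst (λ zs → untouched G j zs ≤ h (size G zs)) (map-nth d zs)
      (Search.untouched-bound h H antitone G (nth d zs) hs j (upTo (length zs)) s)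

  nonStar-untouched : ∀ j n {xs} → length xs ≡ n → NonStar G xs →
    Search.search h hints-2K₂ (sublists 2 (upTo n)) (sublists j (upTo n)) 0 ≡ true →
    Search.search h hints-K₃ (sublists 2 (upTo n)) (sublists j (upTo n)) 0 ≡ true →
    untouched G j xs ≤ h (size G xs)
  nonStar-untouched j n len (nonStar u i (2K₂ {u = d} e e′)) s₂ s₃ =
    hinted-untouched hints-2K₂ j n d (proj₂ (extract u i)) len (edge-touches G e ∷ edge-touches G e′ ∷ []) s₂
  nonStar-untouched j n len (nonStar u i (K₃ {u = d} e e′ e″)) s₂ s₃ =
    hinted-untouched hints-K₃ j n d (proj₂ (extract u i)) len (edge-touches G e ∷ edge-touches G e′ ∷ edge-touches G e″ ∷ []) s₃

-- Tight for two disjoint edges, which 16 of the 35 four-sets avoid.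
nonStar-untouched₇ : ∀ (G : Graph V) {xs} → length xs ≡ 7 → NonStar G xs → untouched G 4 xs ≤ 18 ∸ size G xs
nonStar-untouched₇ G len ns = nonStar-untouched (18 ∸_) (∸-monoʳ-≤ 18) G 4 7 len ns refl refl

-- Among the 35 triples, 10 contain one of two given disjoint edges and 13 an edge of a given
-- triangle, so 25 is attained by two disjoint edges.
nonStar-untouched-triples : ∀ (G : Graph V) {xs} → length xs ≡ 7 → NonStar G xs → untouched G 3 xs ≤ 25
nonStar-untouched-triples G len ns = nonStar-untouched (const 25) (λ _ → ≤-refl) G 3 7 len ns refl refl

-- The bound function vanishes from 19 edges on, and 35 is the number of triples.
dense-untouched : ∀ (G : Graph V) xs → length xs ≡ 7 → 19 ≤ size G xs → untouched G 3 xs ≡ 0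
dense-untouched G xs@(d ∷ _) len dense = n≤0⇒n≡0 (≤-trans
  (hinted-untouched (λ k → 35 * (19 ∸ k)) (λ p → *-monoʳ-≤ 35 (∸-monoʳ-≤ 19 p)) G [] 3 7 {xs} d refl len [] refl)
  (≤-reflexive (cong (35 *_) (m≤n⇒m∸n≡0 dense))))

-- Common 4-sets through one vertex

tri : ℕ → ℕ
tri zero    = 0
tri (suc n) = n + tri n

∑₂-const : ∀ (xs : List V) → ∑ 2 (const 1) xs ≡ tri (length xs)
∑₂-const []       = refl
∑₂-const (x ∷ xs) = cong₂ _+_ (≡-trans (∑₁-const 1 xs) (*-identityʳ _)) (∑₂-const xs)

-- `tri n` is the binomial coefficient n choose 2. For n = 6 the inequality reads 14 ≤ 15 and for n
-- = 5 it fails, which is why `shared-neighbour` asks for seven vertices besides `x`.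
tri-bound : ∀ n → 6 ≤ n → 2 * suc n ≤ tri n
tri-bound n p = subst (λ n → 2 * suc n ≤ tri n) (m+[n∸m]≡n p) (go (n ∸ 6))
  where
  open ≤-Reasoning
  go : ∀ k → 2 * (7 + k) ≤ tri (6 + k)
  go zero    = m≤m+n 14 1
  go (suc k) = begin
    2 * (8 + k)               ≡⟨ lemma k ⟩
    2 + 2 * (7 + k)           ≤⟨ +-mono-≤ {2} {6 + k} (s≤s (s≤s z≤n)) (go k) ⟩
    6 + k + tri (6 + k)       ∎
    where
    lemma : ∀ k → 2 * (8 + k) ≡ 2 + 2 * (7 + k)
    lemma = solve-∀

deg : Graph V → V → List V → ℕ
deg G x = ∑ 1 (λ l → ι (touch G (x ∷ l)))

deg≤length : ∀ (G : Graph V) x xs → deg G x xs ≤ length xs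
deg≤length G x xs = ≤-trans (∑-mono 1 xs λ l → ι≤1 (touch G (x ∷ l)))
  (≤-reflexive (≡-trans (∑₁-const 1 xs) (*-identityʳ _)))

length≤∑₁ : ∀ {f : List V → ℕ} xs → (∀ l → 1 ≤ f l) → length xs ≤ ∑ 1 f xs
length≤∑₁ xs h = ≤-trans (≤-reflexive (sym (≡-trans (∑₁-const 1 xs) (*-identityʳ _)))) (∑-mono 1 xs h)

common : ℕ → Graph V → Graph V → List V → ℕ
common k A B = ∑ k (λ l → ι (touch A l ∧ touch B l))

-- By the defining equation of `∑` this is the part of `common 4 A B (x ∷ ws)` that belongs to the
-- 4-sets through `x`.
commonAt : Graph V → Graph V → V → List V → ℕ
commonAt A B x = ∑ 3 (λ l → ι (touch A (x ∷ l) ∧ touch B (x ∷ l)))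

ι-true : ∀ {b} → b ≡ true → 1 ≤ ι b
ι-true refl = ≤-refl

ι-pos : ∀ {b} → 0 < ι b → b ≡ true
ι-pos {true} _ = refl

∈-extract : ∀ {x : V} {xs} → x ∈ xs → ∃[ ys ] xs ↭ x ∷ ys
∈-extract {x = x} i with as , bs , refl ← ∈-∃++ i = as ++ bs , shift x as bs

module _ (A B : Graph V) (x : V) where

  Symmetric-deg : ∀ (G : Graph V) → Symmetric (λ l → ι (touch G (x ∷ l)))
  Symmetric-deg G p = Symmetric-touch G (prep x p)

  Symmetric-commonAt : Symmetric (λ l → ι (touch A (x ∷ l) ∧ touch B (x ∷ l)))
  Symmetric-commonAt p = cong₂ (λ a b → ι (a ∧ b)) (touch-↭ A (prep x p)) (touch-↭ B (prep x p))

  private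
    f : List V → ℕ
    f l = ι (touch A (x ∷ l) ∧ touch B (x ∷ l))

    both : ∀ l → touch A (x ∷ l) ≡ true → touch B (x ∷ l) ≡ true → 1 ≤ f l
    both l a b = ι-true (∧-intro a b)

    deg-at : ∀ (G : Graph V) {y} l → touch G (x ∷ y ∷ []) ≡ true → y ∈ l → touch G (x ∷ l) ≡ true
    deg-at G {y} l e i = touch-⊆ G (x ∷ y ∷ []) (x ∷ l) (λ { (here refl) → here refl ; (there (here refl)) → there i }) e

  -- A neighbour of x in both graphs makes every 4-set through it and x count.
  shared-neighbour : ∀ {y ws} → 7 ≤ length ws → y ∈ ws → touch A (x ∷ y ∷ []) ≡ true → touch B (x ∷ y ∷ []) ≡ true →
                     deg A x ws + deg B x ws ≤ commonAt A B x ws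
  shared-neighbour {y} {ws} 7≤ i a b with ∈-extract i
  ... | zs , p = begin
    deg A x ws + deg B x ws               ≤⟨ +-mono-≤ (deg≤length A x ws) (deg≤length B x ws) ⟩
    length ws + length ws                 ≡⟨ cong (length ws +_) (+-identityʳ _) ⟨
    2 * length ws                         ≡⟨ cong (2 *_) (↭-length p) ⟩
    2 * suc (length zs)                   ≤⟨ tri-bound _ (s≤s⁻¹ (subst (7 ≤_) (↭-length p) 7≤)) ⟩
    tri (length zs)                       ≡⟨ ∑₂-const zs ⟨
    ∑ 2 (const 1) zs
        ≤⟨ ∑-mono 2 zs (λ l → both (y ∷ l) (deg-at A (y ∷ l) a (here refl)) (deg-at B (y ∷ l) b (here refl))) ⟩
    ∑ 2 (λ l → f (y ∷ l)) zs              ≤⟨ m≤m+n _ _ ⟩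
    ∑ 3 f (y ∷ zs)                        ≡⟨ ∑-↭ 3 Symmetric-commonAt p ⟨
    commonAt A B x ws                     ∎
    where open ≤-Reasoning

  degree-sum : ∀ ws → (∀ {y} → y ∈ ws → touch A (x ∷ y ∷ []) ∧ touch B (x ∷ y ∷ []) ≡ false) →
               deg A x ws + deg B x ws ≤ length ws
  degree-sum []       h = z≤n
  degree-sum (y ∷ ws) h = begin
    (ι a + deg A x ws) + (ι b + deg B x ws)   ≡⟨ interchange (ι a) _ _ _ ⟩
    (ι a + ι b) + (deg A x ws + deg B x ws)   ≤⟨ +-mono-≤ (ι-∧-false a b (h (here refl))) (degree-sum ws (h ∘ there)) ⟩
    suc (length ws)                           ∎
    where
    open ≤-Reasoning
    a = touch A (x ∷ y ∷ [])
    b = touch B (x ∷ y ∷ [])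
    ι-∧-false : ∀ a b → a ∧ b ≡ false → ι a + ι b ≤ 1
    ι-∧-false true  false _ = ≤-refl
    ι-∧-false false b     _ = ι≤1 b

  private
    through₂ : ∀ {y r zs} → 5 ≤ length zs → r ∈ zs → (∀ l → 1 ≤ f (y ∷ r ∷ l)) → 2 ≤ ∑ 2 (f ∘ (y ∷_)) zs
    through₂ {y} {r} {zs} 5≤ i h with ∈-extract i
    ... | rs , p = begin
      2                              ≤⟨ s≤s⁻¹ (≤-trans (m≤n+m 3 2) (subst (5 ≤_) (↭-length p) 5≤)) ⟩
      length rs                      ≤⟨ length≤∑₁ rs h ⟩
      ∑ 1 (λ l → f (y ∷ r ∷ l)) rs   ≤⟨ m≤m+n _ _ ⟩
      ∑ 2 (f ∘ (y ∷_)) (r ∷ rs)      ≡⟨ ∑-↭ 2 (Symmetric-commonAt ∘ prep y) p ⟨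
      ∑ 2 (f ∘ (y ∷_)) zs            ∎
      where open ≤-Reasoning

  -- The sets {x, y, z, ·} give two fewer than the number of vertices in `ws`, which bounds the
  -- degree sum as no neighbour is shared. A third neighbour `r` of `x` in either graph supplies two
  -- more sets, through `r` and only one of `y` and `z`; without it both degrees are at most 2 and
  -- there are enough sets anyway.
  distinct-neighbours : ∀ {y z ws} → 7 ≤ length ws →
    (∀ {y} → y ∈ ws → touch A (x ∷ y ∷ []) ∧ touch B (x ∷ y ∷ []) ≡ false) →
    y ∈ ws → z ∈ ws → touch A (x ∷ y ∷ []) ≡ true → touch B (x ∷ z ∷ []) ≡ true →
    deg A x ws + deg B x ws ≤ commonAt A B x ws
  distinct-neighbours {y} {z} {ws} 7≤ disj i j a b = go (extract {cs = y ∷ z ∷ []} ((y≢z ∷ []) ∷ [] ∷ [])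
      λ { (here refl) → i ; (there (here refl)) → j })
    where
    open ≤-Reasoning
    y≢z : y ≢ z
    y≢z refl with () ← ≡-trans (sym (disj i)) (∧-intro a b)
    go : ∃[ zs ] ws ↭ y ∷ z ∷ zs → deg A x ws + deg B x ws ≤ commonAt A B x ws
    go (zs , p) = begin
      deg A x ws + deg B x ws                                                       ≤⟨ main ⟩
      length zs + (∑ 2 (f ∘ (y ∷_)) zs + ∑ 2 (f ∘ (z ∷_)) zs)                       ≤⟨ +-monoˡ-≤ _ yz ⟩
      ∑ 1 (λ l → f (y ∷ z ∷ l)) zs + (∑ 2 (f ∘ (y ∷_)) zs + ∑ 2 (f ∘ (z ∷_)) zs)
          ≡⟨ +-assoc (∑ 1 (λ l → f (y ∷ z ∷ l)) zs) _ _ ⟨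
      ∑ 1 (λ l → f (y ∷ z ∷ l)) zs + ∑ 2 (f ∘ (y ∷_)) zs + ∑ 2 (f ∘ (z ∷_)) zs
          ≤⟨ +-monoʳ-≤ (∑ 1 (λ l → f (y ∷ z ∷ l)) zs + ∑ 2 (f ∘ (y ∷_)) zs) (m≤m+n _ _) ⟩
      ∑ 3 f (y ∷ z ∷ zs)                                                            ≡⟨ ∑-↭ 3 Symmetric-commonAt p ⟨
      commonAt A B x ws                                                             ∎
      where
      yz : length zs ≤ ∑ 1 (λ l → f (y ∷ z ∷ l)) zs
      yz = length≤∑₁ zs λ l → both (y ∷ z ∷ l) (deg-at A (y ∷ z ∷ l) a (here refl)) (deg-at B (y ∷ z ∷ l) b (there (here refl)))
      5≤ : 5 ≤ length zs
      5≤ = s≤s⁻¹ (s≤s⁻¹ (subst (7 ≤_) (↭-length p) 7≤))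
      enough : ∀ {k} → 2 ≤ k → deg A x ws + deg B x ws ≤ length zs + k
      enough {k} 2≤k = begin
        deg A x ws + deg B x ws   ≤⟨ degree-sum ws disj ⟩
        length ws                 ≡⟨ ↭-length p ⟩
        2 + length zs             ≡⟨ +-comm 2 _ ⟩
        length zs + 2             ≤⟨ +-monoʳ-≤ _ 2≤k ⟩
        length zs + k             ∎
      few : ∀ (G : Graph V) → deg G x zs ≡ 0 → deg G x ws ≤ 2
      few G e = begin
        deg G x ws                 ≡⟨ ∑-↭ 1 (Symmetric-deg G) p ⟩
        ι (touch G (x ∷ y ∷ [])) + (ι (touch G (x ∷ z ∷ [])) + deg G x zs)
            ≤⟨ +-mono-≤ (ι≤1 (touch G (x ∷ y ∷ []))) (+-mono-≤ (ι≤1 (touch G (x ∷ z ∷ []))) (≤-reflexive e)) ⟩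
        2                          ∎
      main : deg A x ws + deg B x ws ≤ length zs + (∑ 2 (f ∘ (y ∷_)) zs + ∑ 2 (f ∘ (z ∷_)) zs)
      main with ∑₁-pos (λ l → ι (touch A (x ∷ l))) zs | ∑₁-pos (λ l → ι (touch B (x ∷ l))) zs
      ... | inj₂ (r , k , q) | _ = enough (≤-trans (through₂ 5≤ k λ l → both (z ∷ r ∷ l)
              (deg-at A (z ∷ r ∷ l) (ι-pos q) (there (here refl))) (deg-at B (z ∷ r ∷ l) b (here refl))) (m≤n+m _ _))
      ... | inj₁ _ | inj₂ (r , k , q) = enough (≤-trans (through₂ 5≤ k λ l → both (y ∷ r ∷ l)
              (deg-at A (y ∷ r ∷ l) a (here refl)) (deg-at B (y ∷ r ∷ l) (ι-pos q) (there (here refl)))) (m≤m+n _ _))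
      ... | inj₁ e | inj₁ e′ = ≤-trans (+-mono-≤ (few A e) (few B e′)) (≤-trans (≤-trans (n≤1+n 4) 5≤) (m≤m+n _ _))

  private
    head₂ : ∀ u v zs → ∑ 1 (λ l → f (u ∷ v ∷ l)) zs + ∑ 3 f zs ≤ ∑ 3 f (u ∷ v ∷ zs)
    head₂ u v zs = +-mono-≤ (m≤m+n (∑ 1 (λ l → f (u ∷ v ∷ l)) zs) _) (m≤n+m (∑ 3 f zs) _)

    -- B has the edge uv inside each of these sets, so A only has to join x to one of its elements.
    with-edge : ∀ {u v} l → adj B u v ≡ true → touch A (x ∷ u ∷ v ∷ l) ≡ true → 1 ≤ f (u ∷ v ∷ l)
    with-edge {u} {v} l e a = both (u ∷ v ∷ l) a
      (touch-intro B (x ∷ u ∷ v ∷ l) (there (here refl)) (there (there (here refl))) e)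

    -- Every `A`-neighbour of `x` lies off the edge `uv` of `B` and forms with `x`, `u`, `v` a 4-set
    -- of its own.
    no-neighbour-on-edge : ∀ {u v zs ws} → ws ↭ u ∷ v ∷ zs → adj B u v ≡ true →
      touch A (x ∷ u ∷ []) ≡ false → touch A (x ∷ v ∷ []) ≡ false → deg A x ws ≤ commonAt A B x ws
    no-neighbour-on-edge {u} {v} {zs} {ws} p e au av = begin
      deg A x ws                       ≡⟨ ∑-↭ 1 (Symmetric-deg A) p ⟩
      deg A x (u ∷ v ∷ zs)             ≡⟨ cong₂ (λ a b → ι a + (ι b + deg A x zs)) au av ⟩
      deg A x zs                       ≤⟨ ∑-mono 1 zs (λ l → ι-mono λ a → ι-pos (with-edge l e
                                            (touch-⊆ A (x ∷ l) (x ∷ u ∷ v ∷ l) (λ { (here q) → here q ; (there i) → there (there (there i)) }) a))) ⟩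
      ∑ 1 (λ l → f (u ∷ v ∷ l)) zs     ≤⟨ m≤m+n _ _ ⟩
      ∑ 1 (λ l → f (u ∷ v ∷ l)) zs + ∑ 3 f zs  ≤⟨ head₂ u v zs ⟩
      ∑ 3 f (u ∷ v ∷ zs)               ≡⟨ ∑-↭ 3 Symmetric-commonAt p ⟨
      commonAt A B x ws                ∎
      where open ≤-Reasoning

    neighbour-on-edge : ∀ {u v zs} → adj B u v ≡ true → touch A (x ∷ u ∷ []) ≡ true ⊎ touch A (x ∷ v ∷ []) ≡ true →
      length zs ≤ ∑ 1 (λ l → f (u ∷ v ∷ l)) zs
    neighbour-on-edge {u} {v} {zs} e n = length≤∑₁ zs λ l → with-edge l e
      ([ (λ a → deg-at A (u ∷ v ∷ l) a (here refl)) , (λ a → deg-at A (u ∷ v ∷ l) a (there (here refl))) ]′ n)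

    neighbour? : ∀ u v → (touch A (x ∷ u ∷ []) ≡ true ⊎ touch A (x ∷ v ∷ []) ≡ true) ⊎
                         (touch A (x ∷ u ∷ []) ≡ false × touch A (x ∷ v ∷ []) ≡ false)
    neighbour? u v with true? (touch A (x ∷ u ∷ [])) | true? (touch A (x ∷ v ∷ []))
    ... | inj₁ a | _      = inj₁ (inj₁ a)
    ... | inj₂ _ | inj₁ b = inj₁ (inj₂ b)
    ... | inj₂ a | inj₂ b = inj₂ (a , b)

    -- All sets {x, u, v, ·} and {x, u, w, ·} count. There are 1 + |ds| of the first kind and,
    -- leaving out `v`, |ds| more of the second, against a degree of at most 3 + |ds|.
    K₃-neighbour : ∀ {u v w ds ws} → 7 ≤ length ws → ws ↭ u ∷ v ∷ w ∷ ds → adj B u v ≡ true → adj B u w ≡ true →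
      touch A (x ∷ u ∷ []) ≡ true → deg A x ws ≤ commonAt A B x ws
    K₃-neighbour {u} {v} {w} {ds} {ws} 7≤ p uv uw a = begin
      deg A x ws                                                               ≤⟨ deg≤length A x ws ⟩
      length ws                                                                ≡⟨ ↭-length p ⟩
      3 + length ds                                                            ≡⟨ +-comm 2 (suc (length ds)) ⟩
      suc (length ds) + 2                                                      ≤⟨ +-monoʳ-≤ (suc (length ds)) 2≤ ⟩
      suc (length ds) + length ds
          ≤⟨ +-mono-≤ (neighbour-on-edge {zs = w ∷ ds} uv (inj₁ a)) (neighbour-on-edge {zs = ds} uw (inj₁ a)) ⟩
      ∑ 1 (λ l → f (u ∷ v ∷ l)) (w ∷ ds) + ∑ 1 (λ l → f (u ∷ w ∷ l)) ds
          ≤⟨ +-monoʳ-≤ (∑ 1 (λ l → f (u ∷ v ∷ l)) (w ∷ ds)) (m≤m+n _ _) ⟩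
      ∑ 2 (λ l → f (u ∷ l)) (v ∷ w ∷ ds)                                       ≤⟨ m≤m+n _ _ ⟩
      ∑ 3 f (u ∷ v ∷ w ∷ ds)                                                   ≡⟨ ∑-↭ 3 Symmetric-commonAt p ⟨
      commonAt A B x ws                                                        ∎
      where
      open ≤-Reasoning
      2≤ : 2 ≤ length ds
      2≤ = ≤-trans (m≤n+m 2 2) (s≤s⁻¹ (s≤s⁻¹ (s≤s⁻¹ (subst (7 ≤_) (↭-length p) 7≤))))

  -- A single edge `uv` of `B` carrying an `A`-neighbour of `x` yields only the sets {x, u, v, ·},
  -- which may fall two short of the degree. The core offers a second edge: either it carries no
  -- neighbour and `no-neighbour-on-edge` applies to it, or its own 4-sets close the gap. In a
  -- triangle another edge through the same neighbour does this.
  one-sided : ∀ {ws} → 7 ≤ length ws → NonStar B ws → deg A x ws ≤ commonAt A B x ws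
  one-sided {ws} 7≤ (nonStar uq i (2K₂ {u} {v} {u′} {v′} e e′)) with extract uq i
  ... | ds , p with neighbour? u v | neighbour? u′ v′
  ...   | inj₂ (a , b) | _ = no-neighbour-on-edge p e a b
  ...   | inj₁ _ | inj₂ (a , b) = no-neighbour-on-edge {zs = u ∷ v ∷ ds} (trans p (shifts (u ∷ v ∷ []) (u′ ∷ v′ ∷ []))) e′ a b
  ...   | inj₁ n | inj₁ n′ = begin
    deg A x ws                                            ≤⟨ deg≤length A x ws ⟩
    length ws                                             ≡⟨ ↭-length p ⟩
    4 + length ds                                         ≡⟨ +-comm 2 (2 + length ds) ⟩
    (2 + length ds) + 2                                   ≤⟨ +-monoʳ-≤ (2 + length ds) 2≤ ⟩
    (2 + length ds) + length ds                           ≤⟨ +-mono-≤ (neighbour-on-edge {zs = u′ ∷ v′ ∷ ds} e n)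
                                                               (≤-trans (neighbour-on-edge {zs = ds} e′ n′) (≤-trans (m≤m+n _ _) (head₂ u′ v′ ds))) ⟩
    ∑ 1 (λ l → f (u ∷ v ∷ l)) (u′ ∷ v′ ∷ ds) + ∑ 3 f (u′ ∷ v′ ∷ ds)  ≤⟨ head₂ u v (u′ ∷ v′ ∷ ds) ⟩
    ∑ 3 f (u ∷ v ∷ u′ ∷ v′ ∷ ds)                          ≡⟨ ∑-↭ 3 Symmetric-commonAt p ⟨
    commonAt A B x ws                                     ∎
    where
    open ≤-Reasoning
    2≤ : 2 ≤ length ds
    2≤ = ≤-trans (n≤1+n 2) (s≤s⁻¹ (s≤s⁻¹ (s≤s⁻¹ (s≤s⁻¹ (subst (7 ≤_) (↭-length p) 7≤)))))
  one-sided {ws} 7≤ (nonStar uq i (K₃ {u} {v} {w} uv uw vw)) with extract uq i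
  ... | ds , p with neighbour? u v
  ...   | inj₂ (a , b) = no-neighbour-on-edge p uv a b
  ...   | inj₁ (inj₁ a) = K₃-neighbour 7≤ p uv uw a
  ...   | inj₁ (inj₂ b) = K₃-neighbour 7≤ (trans p (swap u v refl)) (symm B uv) vw b

commonAt-comm : ∀ (A B : Graph V) x ws → commonAt A B x ws ≤ commonAt B A x ws
commonAt-comm A B x ws = ∑-mono 3 ws λ l → ι-mono λ e → let a , b = ∧-true {touch A (x ∷ l)} e in ∧-intro b a

-- If `x` has no shared neighbour, then either it has different neighbours in the two graphs, or one
-- degree vanishes and the other is bounded through the core of the graph in which `x` has no
-- neighbours.
degrees≤commonAt : ∀ (A B : Graph V) x {ws} → 7 ≤ length ws → NonStar A ws → NonStar B ws →
                   deg A x ws + deg B x ws ≤ commonAt A B x ws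
degrees≤commonAt A B x {ws} 7≤ nA nB with any? (λ y → touch A (x ∷ y ∷ []) ∧ touch B (x ∷ y ∷ [])) ws
... | inj₁ (y , i , e) = let a , b = ∧-true {touch A (x ∷ y ∷ [])} e in shared-neighbour A B x 7≤ i a b
... | inj₂ disj with ∑₁-pos (λ l → ι (touch A (x ∷ l))) ws | ∑₁-pos (λ l → ι (touch B (x ∷ l))) ws
...   | inj₂ (y , i , a) | inj₂ (z , j , b) = distinct-neighbours A B x 7≤ disj i j (ι-pos a) (ι-pos b)
...   | inj₁ a=0 | _ rewrite a=0 = ≤-trans (one-sided B A x 7≤ nA) (commonAt-comm B A x ws)
...   | inj₂ _ | inj₁ b=0 rewrite b=0 | +-identityʳ (deg A x ws) = one-sided A B x 7≤ nB

-- From seven to eight vertices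

∑-const-length : ∀ {W : Set} k c (xs : List V) (ys : List W) → length xs ≡ length ys → ∑ k (const c) xs ≡ ∑ k (const c) ys
∑-const-length zero    c xs       ys       e = refl
∑-const-length (suc k) c []       []       e = refl
∑-const-length (suc k) c (x ∷ xs) (y ∷ ys) e =
  cong₂ _+_ (∑-const-length k c xs ys (suc-injective e)) (∑-const-length (suc k) c xs ys (suc-injective e))

size≤tri : ∀ (G : Graph V) xs → size G xs ≤ tri (length xs)
size≤tri G xs = ≤-trans (∑-mono 2 xs λ l → ι≤1 (touch G l)) (≤-reflexive (∑₂-const xs))

untouched-cover : ∀ k (A B : Graph V) xs → ∑ k (const 1) xs ≤ common k A B xs + (untouched A k xs + untouched B k xs)
untouched-cover k A B xs = begin
  ∑ k (const 1) xs
    ≤⟨ ∑-mono k xs (λ l → cover (touch A l) (touch B l)) ⟩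
  ∑ k (λ l → ι (touch A l ∧ touch B l) + (ι (not (touch A l)) + ι (not (touch B l)))) xs
    ≡⟨ ∑-+ k _ _ xs ⟩
  common k A B xs + ∑ k (λ l → ι (not (touch A l)) + ι (not (touch B l))) xs
    ≡⟨ cong (common k A B xs +_) (∑-+ k _ _ xs) ⟩
  common k A B xs + (untouched A k xs + untouched B k xs) ∎
  where
  open ≤-Reasoning
  cover : ∀ a b → 1 ≤ ι (a ∧ b) + (ι (not a) + ι (not b))
  cover true  true  = ≤-refl
  cover true  false = ≤-refl
  cover false b     = m≤m+n 1 _

-- Truncated subtraction covers dense graphs as well: a non-star with at least 18 edges meets every
-- 4-set, and its term is 0.
common₇ : ∀ (A B : Graph V) {xs} → length xs ≡ 7 → NonStar A xs → NonStar B xs →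
          35 ≤ common 4 A B xs + ((18 ∸ size A xs) + (18 ∸ size B xs))
common₇ A B {xs} len nA nB = begin
  -- On `upTo 7` the number of 4-sets evaluates, and it depends on the length only.
  35                                                                 ≡⟨ ∑-const-length 4 1 xs (upTo 7) len ⟨
  ∑ 4 (const 1) xs                                                   ≤⟨ untouched-cover 4 A B xs ⟩
  common 4 A B xs + (untouched A 4 xs + untouched B 4 xs)
      ≤⟨ +-monoʳ-≤ (common 4 A B xs) (+-mono-≤ (nonStar-untouched₇ A len nA) (nonStar-untouched₇ B len nB)) ⟩
  common 4 A B xs + ((18 ∸ size A xs) + (18 ∸ size B xs))            ∎
  where open ≤-Reasoning

∸-cover : ∀ {m} c s → m ≤ c + (18 ∸ s) → s ≤ 18 → m + s ≤ c + 18
∸-cover {m} c s p q = begin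
  m + s              ≤⟨ +-monoˡ-≤ s p ⟩
  c + (18 ∸ s) + s   ≡⟨ +-assoc c _ s ⟩
  c + ((18 ∸ s) + s) ≡⟨ cong (c +_) (m∸n+n≡m q) ⟩
  c + 18             ∎
  where open ≤-Reasoning

-- Used with 2 d = 1 + (number of 4-sets).
balanced : ∀ d (A B : Graph V) xs → suc (∑ 4 (const 1) xs) ≡ d + d →
           untouched A 4 xs + size A xs ≤ d → untouched B 4 xs + size B xs ≤ d →
           size A xs + size B xs ≤ suc (common 4 A B xs)
balanced d A B xs total a b = +-cancelˡ-≤ (∑ 4 (const 1) xs) _ _ (begin
  ∑ 4 (const 1) xs + (size A xs + size B xs)
    ≤⟨ +-monoˡ-≤ _ (untouched-cover 4 A B xs) ⟩
  common 4 A B xs + (untouched A 4 xs + untouched B 4 xs) + (size A xs + size B xs)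
    ≡⟨ rearrange (common 4 A B xs) (untouched A 4 xs) (untouched B 4 xs) (size A xs) (size B xs) ⟩
  common 4 A B xs + ((untouched A 4 xs + size A xs) + (untouched B 4 xs + size B xs))
    ≤⟨ +-monoʳ-≤ (common 4 A B xs) (+-mono-≤ a b) ⟩
  common 4 A B xs + (d + d)
    ≡⟨ cong (common 4 A B xs +_) total ⟨
  common 4 A B xs + suc (∑ 4 (const 1) xs)
    ≡⟨ shuffle (common 4 A B xs) (∑ 4 (const 1) xs) ⟩
  ∑ 4 (const 1) xs + suc (common 4 A B xs) ∎)
  where
  open ≤-Reasoning
  rearrange : ∀ c p q r s → c + (p + q) + (r + s) ≡ c + ((p + r) + (q + s))
  rearrange = solve-∀
  shuffle : ∀ c k → c + suc k ≡ k + suc c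
  shuffle = solve-∀

≤∸⇒+≤ : ∀ {u s d} → u ≤ d ∸ s → s ≤ d → u + s ≤ d
≤∸⇒+≤ {s = s} p q = ≤-trans (+-monoˡ-≤ s p) (≤-reflexive (m∸n+n≡m q))

sparse₇ : ∀ (A B : Graph V) {xs} → length xs ≡ 7 → NonStar A xs → NonStar B xs → size A xs ≤ 18 → size B xs ≤ 18 →
          size A xs + size B xs ≤ suc (common 4 A B xs)
sparse₇ A B {xs} len nA nB a b = balanced 18 A B xs (cong suc (∑-const-length 4 1 xs (upTo 7) len))
  (≤∸⇒+≤ (nonStar-untouched₇ A len nA) a) (≤∸⇒+≤ (nonStar-untouched₇ B len nB) b)

module _ (A B : Graph V) (x : V) {ws : List V} (len : length ws ≡ 7) where

  private
    τ : ℕ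
    τ = ∑ 3 (λ l → ι (touch B (x ∷ l))) ws

    through : ∀ y zs → touch B (x ∷ y ∷ []) ≡ true → tri (length zs) ≤ ∑ 2 (λ l → ι (touch B (x ∷ y ∷ l))) zs
    through y zs b = ≤-trans (≤-reflexive (sym (∑₂-const zs))) (∑-mono 2 zs λ l → ι-true
      (touch-⊆ B (x ∷ y ∷ []) (x ∷ y ∷ l) (λ { (here p) → here p ; (there (here p)) → there (here p) }) b))

    -- A neighbour of `x` lies in 15 = 6 choose 2 triples of `ws`; a second neighbour adds the 10 =
    -- 5 choose 2 triples that contain it but not the first.
    triples-at : deg B x ws ≡ 0 ⊎ (deg B x ws ≤ 1 × 15 ≤ τ) ⊎ 25 ≤ τ
    triples-at with ∑₁-pos (λ l → ι (touch B (x ∷ l))) ws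
    ... | inj₁ z = inj₁ z
    ... | inj₂ (y , i , b) with ∈-extract i
    ...   | zs , p with ∑₁-pos (λ l → ι (touch B (x ∷ l))) zs
    ...     | inj₁ z = inj₂ (inj₁ (degree , (begin
      15                                           ≡⟨ cong tri zs≡6 ⟨
      tri (length zs)                              ≤⟨ through y zs (ι-pos b) ⟩
      ∑ 2 (λ l → ι (touch B (x ∷ y ∷ l))) zs       ≤⟨ m≤m+n _ _ ⟩
      ∑ 3 (λ l → ι (touch B (x ∷ l))) (y ∷ zs)     ≡⟨ ∑-↭ 3 (Symmetric-deg A B x B) p ⟨
      τ                                            ∎)))
      where
      open ≤-Reasoning
      zs≡6 : length zs ≡ 6
      zs≡6 = suc-injective (≡-trans (sym (↭-length p)) len)
      degree : deg B x ws ≤ 1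
      degree = begin
        deg B x ws                                  ≡⟨ ∑-↭ 1 (Symmetric-deg A B x B) p ⟩
        ι (touch B (x ∷ y ∷ [])) + deg B x zs       ≤⟨ +-mono-≤ (ι≤1 (touch B (x ∷ y ∷ []))) (≤-reflexive z) ⟩
        1                                           ∎
    ...     | inj₂ (y′ , i′ , b′) with ∈-extract i′
    ...       | zs′ , p′ = inj₂ (inj₂ (begin
      15 + 10                                      ≡⟨ cong₂ _+_ (cong tri zs≡6) (cong tri zs′≡5) ⟨
      tri (length zs) + tri (length zs′)
          ≤⟨ +-mono-≤ (through y zs (ι-pos b)) (≤-trans (through y′ zs′ (ι-pos b′)) (m≤m+n _ _)) ⟩
      ∑ 2 (λ l → ι (touch B (x ∷ y ∷ l))) zs + ∑ 3 (λ l → ι (touch B (x ∷ l))) (y′ ∷ zs′)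
                                                   ≡⟨ cong (∑ 2 (λ l → ι (touch B (x ∷ y ∷ l))) zs +_) (∑-↭ 3 (Symmetric-deg A B x B) p′) ⟨
      ∑ 3 (λ l → ι (touch B (x ∷ l))) (y ∷ zs)     ≡⟨ ∑-↭ 3 (Symmetric-deg A B x B) p ⟨
      τ                                            ∎))
      where
      open ≤-Reasoning
      zs≡6 : length zs ≡ 6
      zs≡6 = suc-injective (≡-trans (sym (↭-length p)) len)
      zs′≡5 : length zs′ ≡ 5
      zs′≡5 = suc-injective (≡-trans (sym (↭-length p′)) zs≡6)

    τ-untouched : 35 ≤ τ + untouched B 3 ws
    τ-untouched = begin
      35                                                             ≡⟨ ∑-const-length 3 1 ws (upTo 7) len ⟨
      ∑ 3 (const 1) ws                                               ≤⟨ ∑-mono 3 ws (λ l → cover l) ⟩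
      ∑ 3 (λ l → ι (touch B (x ∷ l)) + ι (not (touch B l))) ws       ≡⟨ ∑-+ 3 _ _ ws ⟩
      τ + untouched B 3 ws                                           ∎
      where
      open ≤-Reasoning
      cover : ∀ l → 1 ≤ ι (touch B (x ∷ l)) + ι (not (touch B l))
      cover l with touch B l in eq
      ... | true  rewrite ∨-introʳ {any (adj B x) l} {true} refl = ≤-refl
      ... | false = m≤n+m 1 _

  -- Every triple contains an edge of A, so only B matters.
  dense-commonAt : 19 ≤ size A ws → ∀ e → e ≤ 6 → e + untouched B 3 ws ≤ 28 →
                   (deg A x ws + deg B x ws) + e ≤ commonAt A B x ws
  dense-commonAt dense e e≤6 room = ≤-trans main τ≤
    where
    open ≤-Reasoning
    τ≤ : τ ≤ commonAt A B x ws
    τ≤ = begin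
      τ                                                   ≤⟨ ∑-mono 3 ws (λ l → split l) ⟩
      ∑ 3 (λ l → ι (touch A (x ∷ l) ∧ touch B (x ∷ l)) + ι (not (touch A l))) ws  ≡⟨ ∑-+ 3 _ _ ws ⟩
      commonAt A B x ws + untouched A 3 ws                ≡⟨ cong (commonAt A B x ws +_) (dense-untouched A ws len dense) ⟩
      commonAt A B x ws + 0                               ≡⟨ +-identityʳ _ ⟩
      commonAt A B x ws                                   ∎
      where
      split : ∀ l → ι (touch B (x ∷ l)) ≤ ι (touch A (x ∷ l) ∧ touch B (x ∷ l)) + ι (not (touch A l))
      split l with touch A l
      ... | true  rewrite ∨-introʳ {any (adj A x) l} {true} refl = m≤m+n _ 0
      ... | false = ≤-trans (ι≤1 (touch B (x ∷ l))) (m≤n+m 1 _)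
    a≤7 : deg A x ws ≤ 7
    a≤7 = ≤-trans (deg≤length A x ws) (≤-reflexive len)
    b≤7 : deg B x ws ≤ 7
    b≤7 = ≤-trans (deg≤length B x ws) (≤-reflexive len)
    main : (deg A x ws + deg B x ws) + e ≤ τ
    main with triples-at
    -- The three cases compare 7 + 28 with all 35 triples, 7 + 1 + 6 with 15, and 7 + 7 + 6 with 25.
    ... | inj₁ b=0 = +-cancelʳ-≤ (untouched B 3 ws) _ _ (begin
      deg A x ws + deg B x ws + e + untouched B 3 ws      ≡⟨ +-assoc (deg A x ws + deg B x ws) e _ ⟩
      deg A x ws + deg B x ws + (e + untouched B 3 ws)    ≤⟨ +-mono-≤ (+-mono-≤ a≤7 (≤-reflexive b=0)) room ⟩
      35                                                  ≤⟨ τ-untouched ⟩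
      τ + untouched B 3 ws                                ∎)
    ... | inj₂ (inj₁ (b≤1 , 15≤τ)) = ≤-trans (+-mono-≤ (+-mono-≤ a≤7 b≤1) e≤6) (≤-trans (n≤1+n 14) 15≤τ)
    ... | inj₂ (inj₂ 25≤τ) = ≤-trans (+-mono-≤ (+-mono-≤ a≤7 b≤7) e≤6) (≤-trans (m≤n+m 20 5) 25≤τ)

  -- On `ws` the inequality can fail by 21 - 18 = 3 for each dense graph. The 4-sets through `x`
  -- have to make up for it, so the surplus `e` requested from `dense-commonAt` is 3 if only `A` is
  -- dense and 6 if both are.
  dense₈ : NonStar A ws → NonStar B ws → 19 ≤ size A ws →
           size A (x ∷ ws) + size B (x ∷ ws) ≤ suc (commonAt A B x ws + common 4 A B ws)
  dense₈ nA nB dense with ≤-<-connex (size B ws) 18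
  ... | inj₁ b≤18 = +-cancelˡ-≤ 17 _ _ (begin
    17 + (deg A x ws + size A ws + (deg B x ws + size B ws))
        ≤⟨ +-monoʳ-≤ 17 (+-monoˡ-≤ (deg B x ws + size B ws) (+-monoʳ-≤ (deg A x ws) a≤21)) ⟩
    17 + (deg A x ws + 21 + (deg B x ws + size B ws))              ≡⟨ l₁ (deg A x ws) (deg B x ws) (size B ws) ⟩
    (deg A x ws + deg B x ws + 3) + (35 + size B ws)
        ≤⟨ +-mono-≤ (dense-commonAt dense 3 (m≤m+n 3 3) (+-monoʳ-≤ 3 (nonStar-untouched-triples B len nB)))
                                                                        (∸-cover (common 4 A B ws) (size B ws) cover b≤18) ⟩
    commonAt A B x ws + (common 4 A B ws + 18)                     ≡⟨ l₂ (commonAt A B x ws) (common 4 A B ws) ⟩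
    17 + suc (commonAt A B x ws + common 4 A B ws)                 ∎)
    where
    open ≤-Reasoning
    a≤21 : size A ws ≤ 21
    a≤21 = ≤-trans (size≤tri A ws) (≤-reflexive (cong tri len))
    cover : 35 ≤ common 4 A B ws + (18 ∸ size B ws)
    cover = subst (λ k → 35 ≤ common 4 A B ws + (k + (18 ∸ size B ws))) (m≤n⇒m∸n≡0 (≤-trans (n≤1+n 18) dense)) (common₇ A B len nA nB)
    l₁ : ∀ a b s → 17 + (a + 21 + (b + s)) ≡ (a + b + 3) + (35 + s)
    l₁ = solve-∀
    l₂ : ∀ p q → p + (q + 18) ≡ 17 + suc (p + q)
    l₂ = solve-∀
  ... | inj₂ 19≤b = begin
    deg A x ws + size A ws + (deg B x ws + size B ws)
        ≤⟨ +-mono-≤ (+-monoʳ-≤ (deg A x ws) a≤21) (+-monoʳ-≤ (deg B x ws) b≤21) ⟩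
    deg A x ws + 21 + (deg B x ws + 21)                     ≡⟨ l₁ (deg A x ws) (deg B x ws) ⟩
    suc (deg A x ws + deg B x ws + 6 + 35)
        ≤⟨ s≤s (+-mono-≤ (dense-commonAt dense 6 ≤-refl (≤-trans (≤-reflexive (cong (6 +_) (dense-untouched B ws len 19≤b))) (m≤m+n 6 22))) cover) ⟩
    suc (commonAt A B x ws + common 4 A B ws)               ∎
    where
    open ≤-Reasoning
    a≤21 : size A ws ≤ 21
    a≤21 = ≤-trans (size≤tri A ws) (≤-reflexive (cong tri len))
    b≤21 : size B ws ≤ 21
    b≤21 = ≤-trans (size≤tri B ws) (≤-reflexive (cong tri len))
    cover : 35 ≤ common 4 A B ws
    cover = subst (35 ≤_) (+-identityʳ _) (subst (λ k → 35 ≤ common 4 A B ws + k)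
      (cong₂ _+_ (m≤n⇒m∸n≡0 (≤-trans (n≤1+n 18) dense)) (m≤n⇒m∸n≡0 (≤-trans (n≤1+n 18) 19≤b))) (common₇ A B len nA nB))
    l₁ : ∀ a b → a + 21 + (b + 21) ≡ suc (a + b + 6 + 35)
    l₁ = solve-∀

-- Two non-stars have few edges compared with the 4-sets containing an edge of both

common-comm : ∀ (A B : Graph V) xs → common 4 A B xs ≤ common 4 B A xs
common-comm A B xs = ∑-mono 4 xs λ l → ι-mono λ e → let a , b = ∧-true {touch A l} e in ∧-intro b a

Symmetric-common : ∀ (A B : Graph V) → Symmetric (λ l → ι (touch A l ∧ touch B l))
Symmetric-common A B p = cong₂ (λ a b → ι (a ∧ b)) (touch-↭ A p) (touch-↭ B p)

Meet : Graph V → Graph V → List V → Set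
Meet A B xs = size A xs + size B xs ≤ suc (common 4 A B xs)

Meet-↭ : ∀ (A B : Graph V) {xs ys} → xs ↭ ys → Meet A B ys → Meet A B xs
Meet-↭ A B p m
  rewrite ∑-↭ 2 (Symmetric-touch A) p | ∑-↭ 2 (Symmetric-touch B) p | ∑-↭ 4 (Symmetric-common A B) p = m

Meet-sym : ∀ (A B : Graph V) {xs} → Meet B A xs → Meet A B xs
Meet-sym A B {xs} m = ≤-trans (≤-reflexive (+-comm (size A xs) _)) (≤-trans m (s≤s (common-comm B A xs)))

Meet-∷ : ∀ (A B : Graph V) x ws → 7 ≤ length ws → NonStar A ws → NonStar B ws → Meet A B ws → Meet A B (x ∷ ws)
Meet-∷ A B x ws 7≤ nA nB m = begin
  deg A x ws + size A ws + (deg B x ws + size B ws)      ≡⟨ interchange (deg A x ws) _ _ _ ⟩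
  deg A x ws + deg B x ws + (size A ws + size B ws)      ≤⟨ +-mono-≤ (degrees≤commonAt A B x 7≤ nA nB) m ⟩
  commonAt A B x ws + suc (common 4 A B ws)              ≡⟨ +-suc _ _ ⟩
  suc (commonAt A B x ws + common 4 A B ws)              ∎
  where open ≤-Reasoning

-- Up to 18 edges in each graph, `sparse₇` supplies the inequality on `ws`. From 19 edges on at most
-- two of the 21 pairs are missing, too few for a triple without an edge, and `dense₈` takes over.
Meet-∷₈ : ∀ (A B : Graph V) x ws → length ws ≡ 7 → NonStar A ws → NonStar B ws → Meet A B (x ∷ ws)
Meet-∷₈ A B x ws len nA nB with ≤-<-connex (size A ws) 18 | ≤-<-connex (size B ws) 18
... | inj₁ a≤ | inj₁ b≤ = Meet-∷ A B x ws (≤-reflexive (sym len)) nA nB (sparse₇ A B len nA nB a≤ b≤)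
... | inj₂ a≥ | _       = dense₈ A B x len nA nB a≥
... | inj₁ _  | inj₂ b≥ = Meet-sym A B {x ∷ ws} (dense₈ B A x len nB nA b≥)

nonStar-drop : ∀ {G : Graph V} {x xs ws} → xs ↭ x ∷ ws → (ns : NonStar G xs) → x ∉ vertices ns → NonStar G ws
nonStar-drop p (nonStar u s c) x∉ = nonStar u (λ i → case ∈-resp-↭ p (s i) of λ where
  (here refl) → ⊥-elim (x∉ i)
  (there j)   → j) c

size-++ : ∀ (G : Graph V) xs ys → (∀ {s t} → s ∈ xs ++ ys → t ∈ ys → adj G s t ≡ false) → size G (xs ++ ys) ≤ size G xs
size-++ G [] ys h with size G ys in eq
... | zero  = z≤n
... | suc _ with l , s , p ← ∑-pos 2 _ ys (subst (0 <_) (sym eq) (s≤s z≤n))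
            with x , y , i , j , e ← touch-true G {l} (ι-pos p)
            with () ← ≡-trans (sym e) (h (s i) (s j))
size-++ G (x ∷ xs) ys h = +-mono-≤ (deg-++ xs) (size-++ G xs ys λ i → h (there i))
  where
  absent : ∀ zs → (∀ {t} → t ∈ zs → adj G x t ≡ false) → deg G x zs ≤ 0
  absent []       _ = z≤n
  absent (z ∷ zs) g rewrite g (here refl) = absent zs (g ∘ there)
  deg-++ : ∀ xs → deg G x (xs ++ ys) ≤ deg G x xs
  deg-++ []       = absent ys (h (here refl))
  deg-++ (z ∷ xs) = +-monoʳ-≤ (ι (touch G (x ∷ z ∷ []))) (deg-++ xs)

-- This is (m - 1)(n - 1) ≥ 0.
+≤1+* : ∀ m n → 1 ≤ m → 1 ≤ n → m + n ≤ suc (m * n)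
+≤1+* (suc m) (suc n) _ _ = s≤s (begin
  m + suc n          ≡⟨ +-comm m (suc n) ⟩
  suc n + m          ≤⟨ +-monoʳ-≤ (suc n) (m≤m*n m (suc n)) ⟩
  suc n + m * suc n  ∎)
  where open ≤-Reasoning

module _ (A B : Graph V) where

  -- An edge of `A` inside `xs` and an edge of `B` inside `ys` unite to a 4-set that determines
  -- both.
  product≤common : ∀ xs ys → size A xs * size B ys ≤ common 4 A B (xs ++ ys)
  product≤common xs ys = begin
    size A xs * size B ys
      ≡⟨ ∑-*ʳ 2 _ (size B ys) xs ⟨
    ∑ 2 (λ l → ι (touch A l) * size B ys) xs
      ≤⟨ ∑-mono 2 xs (λ l → ≤-reflexive (sym (∑-*ˡ 2 _ (ι (touch A l)) ys))) ⟩
    ∑ 2 (λ l → ∑ 2 (λ l′ → ι (touch A l) * ι (touch B l′)) ys) xs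
      ≤⟨ ∑-mono 2 xs (λ l → ∑-mono 2 ys λ l′ → union l l′) ⟩
    ∑ 2 (λ l → ∑ 2 (λ l′ → ι (touch A (l ++ l′) ∧ touch B (l ++ l′))) ys) xs
      ≤⟨ ∑-∑-≤-++ 2 2 _ xs ys ⟩
    common 4 A B (xs ++ ys) ∎
    where
    open ≤-Reasoning
    union : ∀ l l′ → ι (touch A l) * ι (touch B l′) ≤ ι (touch A (l ++ l′) ∧ touch B (l ++ l′))
    union l l′ with touch A l in a | touch B l′ in b
    ... | false | _     = z≤n
    ... | true  | false = z≤n
    ... | true  | true  = ι-true (∧-intro (touch-⊆ A l (l ++ l′) (xs⊆xs++ys l l′) a)
                                          (touch-⊆ B l′ (l ++ l′) (xs⊆ys++xs l′ l) b))

  Meet-separated : ∀ P Q → (∀ {s t} → s ∈ P ++ Q → t ∈ Q → adj A s t ≡ false) →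
                   (∀ {s t} → s ∈ Q ++ P → t ∈ P → adj B s t ≡ false) →
                   1 ≤ size A P → 1 ≤ size B Q → Meet A B (P ++ Q)
  Meet-separated P Q hA hB a b = begin
    size A (P ++ Q) + size B (P ++ Q)   ≡⟨ cong (size A (P ++ Q) +_) (∑-↭ 2 (Symmetric-touch B) (++-comm P Q)) ⟩
    size A (P ++ Q) + size B (Q ++ P)   ≤⟨ +-mono-≤ (size-++ A P Q hA) (size-++ B Q P hB) ⟩
    size A P + size B Q                 ≤⟨ +≤1+* _ _ a b ⟩
    suc (size A P * size B Q)           ≤⟨ s≤s (product≤common P Q) ⟩
    suc (common 4 A B (P ++ Q))         ∎
    where open ≤-Reasoning

module _ (_≟_ : DecidableEquality V) where

  open DecMembership _≟_ using (_∈?_)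

  module _ (G : Graph V) where

    private
      avoiding : ∀ {x s t a b} → adj G s t ≡ true → adj G a b ≡ true → Unique (x ∷ s ∷ t ∷ a ∷ b ∷ []) →
                 ∀ {zs} → s ∷ t ∷ a ∷ b ∷ [] ⊆ zs → Σ (NonStar G zs) λ ns → x ∉ vertices ns
      avoiding st ab (x∉ ∷ u) s = nonStar u s (2K₂ st ab) , λ i → lookup x∉ i refl

      -- The edge `st` takes the place of `uv` beside `u′v′`. Since `t` is new and `s` equals at
      -- most one of `u` and `v`, the other one becomes free.
      exchange : ∀ {u v u′ v′ s t} → adj G u′ v′ ≡ true → Unique (u ∷ v ∷ u′ ∷ v′ ∷ []) →
                 t ∉ u ∷ v ∷ u′ ∷ v′ ∷ [] → adj G s t ≡ true → s ≢ u′ → s ≢ v′ →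
                 ∀ {zs} → s ∷ t ∷ u′ ∷ v′ ∷ [] ⊆ zs →
                 ∃[ x ] x ∈ u ∷ v ∷ [] × Σ (NonStar G zs) λ ns → x ∉ vertices ns
      exchange {u} {v} {u′} {v′} {s} {t} e′ ((uv ∷ uu′ ∷ uv′ ∷ []) ∷ (vu′ ∷ vv′ ∷ []) ∷ u′v′) t∉ st su′ sv′ s⊆
        = result (s ≟ u)
        where
        tail : Unique (s ∷ t ∷ u′ ∷ v′ ∷ [])
        tail = ((λ { refl → irrefl G st }) ∷ su′ ∷ sv′ ∷ [])
             ∷ ((λ q → t∉ (there (there (here q)))) ∷ (λ q → t∉ (there (there (there (here q))))) ∷ []) ∷ u′v′
        result : Dec (s ≡ u) → ∃[ x ] x ∈ u ∷ v ∷ [] × Σ (NonStar G _) λ ns → x ∉ vertices ns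
        result (yes refl) = v , there (here refl) ,
          avoiding st e′ ((≢-sym uv ∷ (λ q → t∉ (there (here (sym q)))) ∷ vu′ ∷ vv′ ∷ []) ∷ tail) s⊆
        result (no su) = u , here refl ,
          avoiding st e′ ((≢-sym su ∷ (λ q → t∉ (here (sym q))) ∷ uu′ ∷ uv′ ∷ []) ∷ tail) s⊆

    -- An edge leaving the four vertices of two disjoint edges yields another such pair, which misses one of them.
    escape : ∀ {u v u′ v′ s t} → adj G u v ≡ true → adj G u′ v′ ≡ true → Unique (u ∷ v ∷ u′ ∷ v′ ∷ []) →
             t ∉ u ∷ v ∷ u′ ∷ v′ ∷ [] → adj G s t ≡ true → ∀ {zs} → s ∈ zs → t ∈ zs → u ∷ v ∷ u′ ∷ v′ ∷ [] ⊆ zs →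
             ∃[ x ] x ∈ u ∷ v ∷ u′ ∷ v′ ∷ [] × Σ (NonStar G zs) λ ns → x ∉ vertices ns
    escape {u} {v} {u′} {v′} {s} {t} e e′ uq t∉ st {zs} s∈ t∈ P⊆ with s ∈? u′ ∷ v′ ∷ []
    ... | no s∉ =
      let x , x∈ , r = exchange e′ uq t∉ st (λ q → s∉ (here q)) (λ q → s∉ (there (here q)))
                         λ { (here refl) → s∈ ; (there (here refl)) → t∈ ; (there (there i)) → P⊆ (there (there i)) }
      in x , ∈-++⁺ˡ x∈ , r
    ... | yes s∈′ =
      let x , x∈ , r = exchange e uq′ (t∉ ∘ ∈-resp-↭ (↭-sym p)) st (λ { refl → u∉ s∈′ }) (λ { refl → v∉ s∈′ })
                         λ { (here refl) → s∈ ; (there (here refl)) → t∈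
                           ; (there (there (here refl))) → P⊆ (here refl)
                           ; (there (there (there (here refl)))) → P⊆ (there (here refl)) }
      in x , there (there x∈) , r
      where
      p : u ∷ v ∷ u′ ∷ v′ ∷ [] ↭ u′ ∷ v′ ∷ u ∷ v ∷ []
      p = shifts (u ∷ v ∷ []) (u′ ∷ v′ ∷ [])
      uq′ : Unique (u′ ∷ v′ ∷ u ∷ v ∷ [])
      uq′ = Unique-resp-↭ (setoid V) (↭⇒↭ₛ p) uq
      u∉ : u ∉ u′ ∷ v′ ∷ []
      u∉ i = lookup (AllPairs.head uq) (there i) refl
      v∉ : v ∉ u′ ∷ v′ ∷ []
      v∉ i = lookup (AllPairs.head (AllPairs.tail uq)) i refl

  module _ (A B : Graph V) where

    -- The induction step at a vertex outside both cores. The recursive call is handed in as `rec`,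
    -- guarded by `k ≡ suc k′`, so for eight vertices the inequality on the remaining seven is never
    -- invoked.
    meet-without : ∀ {xs} k → length xs ≡ 8 + k → (nA : NonStar A xs) (nB : NonStar B xs) → ∀ {x} → x ∈ xs →
                   x ∉ vertices nA → x ∉ vertices nB →
                   (∀ k′ {ws} → k ≡ suc k′ → length ws ≡ 8 + k′ → (∃[ x ] xs ↭ x ∷ ws) → NonStar A ws → NonStar B ws → Meet A B ws) →
                   Meet A B xs
    meet-without {xs} k len nA nB {x} i xA xB rec with ∈-extract i
    ... | ws , p = Meet-↭ A B p (go k refl)
      where
      nA′ = nonStar-drop p nA xA
      nB′ = nonStar-drop p nB xB
      len′ : length ws ≡ 7 + k
      len′ = suc-injective (≡-trans (sym (↭-length p)) len)
      go : ∀ k′ → k ≡ k′ → Meet A B (x ∷ ws)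
      go zero     refl = Meet-∷₈ A B x ws len′ nA′ nB′
      go (suc k′) refl = Meet-∷ A B x ws (≤-trans (m≤m+n 7 _) (≤-reflexive (sym len′))) nA′ nB′
                           (rec k′ refl (≡-trans len′ (+-suc 7 k′)) (x , p) nA′ nB′)

    -- If an edge of `A` ends in `Q`, `escape` yields a core of `A` missing some vertex of `P`; that
    -- vertex lies outside `Q` too, so it can be removed. The same holds with `A` and `B`
    -- interchanged. Otherwise `A` lives on `P` and `B` on `Q`, and `Meet-separated` applies.
    meet-disjoint : ∀ {xs u v u′ v′ p q p′ q′} → length xs ≡ 8 → Unique xs →
      xs ↭ (u ∷ v ∷ u′ ∷ v′ ∷ []) ++ (p ∷ q ∷ p′ ∷ q′ ∷ []) →
      adj A u v ≡ true → adj A u′ v′ ≡ true → adj B p q ≡ true → adj B p′ q′ ≡ true → Meet A B xs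
    meet-disjoint {xs} {u} {v} {u′} {v′} {p} {q} {p′} {q′} len uq π a a′ b b′ = go
        (any? (λ t → any (λ s → adj A s t) xs) Q) (any? (λ t → any (λ s → adj B s t) xs) P)
      where
      P = u ∷ v ∷ u′ ∷ v′ ∷ []
      Q = p ∷ q ∷ p′ ∷ q′ ∷ []
      uPQ : Unique (P ++ Q)
      uPQ = Unique-resp-↭ (setoid V) (↭⇒↭ₛ π) uq
      uQP : Unique (Q ++ P)
      uQP = Unique-resp-↭ (setoid V) (↭⇒↭ₛ (++-comm P Q)) uPQ
      P⊆ : P ⊆ xs
      P⊆ i = ∈-resp-↭ (↭-sym π) (∈-++⁺ˡ i)
      Q⊆ : Q ⊆ xs
      Q⊆ i = ∈-resp-↭ (↭-sym π) (∈-++⁺ʳ P i)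
      absent : ∀ (G : Graph V) {R S} → R ++ S ⊆ xs → (∀ {t} → t ∈ S → any (λ s → adj G s t) xs ≡ false) →
               ∀ {s t} → s ∈ R ++ S → t ∈ S → adj G s t ≡ false
      absent G s⊆ h {s} {t} i j with true? (adj G s t)
      ... | inj₂ e = e
      ... | inj₁ e with () ← ≡-trans (sym (h j)) (any-intro _ (s⊆ i) e)
      go : _ → _ → Meet A B xs
      go (inj₁ (t , t∈ , e)) _ with s , s∈ , st ← any-true (λ s → adj A s t) {xs} e
        with x , x∈ , nA , x∉ ← escape A a a′ (unique-++ˡ uPQ) (λ i → unique-++-disjoint uPQ i t∈) st s∈ (Q⊆ t∈) P⊆ =
        meet-without 0 len nA (nonStar (unique-++ˡ uQP) Q⊆ (2K₂ b b′)) (P⊆ x∈) x∉ (unique-++-disjoint uPQ x∈) λ _ ()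
      go (inj₂ _) (inj₁ (t , t∈ , e)) with s , s∈ , st ← any-true (λ s → adj B s t) {xs} e
        with x , x∈ , nB , x∉ ← escape B b b′ (unique-++ˡ uQP) (λ i → unique-++-disjoint uQP i t∈) st s∈ (P⊆ t∈) Q⊆ =
        meet-without 0 len (nonStar (unique-++ˡ uPQ) P⊆ (2K₂ a a′)) nB (Q⊆ x∈) (unique-++-disjoint uQP x∈) x∉ λ _ ()
      go (inj₂ noA) (inj₂ noB) = Meet-↭ A B π (Meet-separated A B P Q
        (absent A {P} {Q} (∈-resp-↭ (↭-sym π)) noA)
        (absent B {Q} {P} (∈-resp-↭ (↭-trans (++-comm Q P) (↭-sym π))) noB)
        (first-edge A a) (first-edge B b))
        where
        first-edge : ∀ (G : Graph V) {c d e f} → adj G c d ≡ true → 1 ≤ size G (c ∷ d ∷ e ∷ f ∷ [])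
        first-edge G e = ≤-trans (ι-true (edge-touches G e)) (≤-trans (m≤m+n _ _) (m≤m+n _ _))

    meet : ∀ k xs → length xs ≡ 8 + k → Unique xs → NonStar A xs → NonStar B xs → Meet A B xs
    meet k xs len uq nA nB with all? (_∈? vertices nA ++ vertices nB) xs
    ... | no ¬covered with x , i , x∉ ← find (All.¬All⇒Any¬ (_∈? vertices nA ++ vertices nB) xs ¬covered) =
        meet-without k len nA nB i (x∉ ∘ ∈-++⁺ˡ) (x∉ ∘ ∈-++⁺ʳ (vertices nA))
          λ k′ k≡ len′ (x , p) → meet′ k′ k≡ len′ (AllPairs.tail (Unique-resp-↭ (setoid V) (↭⇒↭ₛ p) uq))
      where
      meet′ : ∀ k′ {ws} → k ≡ suc k′ → length ws ≡ 8 + k′ → Unique ws → NonStar A ws → NonStar B ws → Meet A B ws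
      meet′ k′ refl = meet k′ _
    -- Two cores have at most eight vertices in all, so covering `xs` forces `k = 0`, two copies of
    -- 2K₂, and no overlap between them.
    ... | yes covered with extract uq (lookup covered)
    ...   | ds , p = go nA nB (≡-trans (↭-length p) (≡-trans (List.length-++ xs) (cong (_+ length ds) len))) p
      where
      go : (nA : NonStar A xs) (nB : NonStar B xs) → length (vertices nA ++ vertices nB) ≡ 8 + k + length ds →
           vertices nA ++ vertices nB ↭ xs ++ ds → Meet A B xs
      go (nonStar _ _ (K₃ _ _ _)) (nonStar _ _ (K₃ _ _ _)) () _
      go (nonStar _ _ (K₃ _ _ _)) (nonStar _ _ (2K₂ _ _)) () _
      go (nonStar _ _ (2K₂ _ _)) (nonStar _ _ (K₃ _ _ _)) () _
      go (nonStar _ _ (2K₂ a a′)) (nonStar _ _ (2K₂ b b′)) e π = finish k ds e len π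
        where
        finish : ∀ k ds → 8 ≡ 8 + k + length ds → length xs ≡ 8 + k → _ ↭ xs ++ ds → Meet A B xs
        finish zero [] _ len π = meet-disjoint len uq (↭-sym (subst (_ ↭_) (List.++-identityʳ xs) π)) a a′ b b′

-- Berge copies and deficient graphs

subsets : ℕ → ∀ n → List (Subset n)
subsets zero    zero    = [] ∷ []
subsets (suc k) zero    = []
subsets zero    (suc n) = map (outside ∷_) (subsets zero n)
subsets (suc k) (suc n) = map (inside ∷_) (subsets k n) ++ map (outside ∷_) (subsets (suc k) n)

subsets-unique : ∀ k n → Unique (subsets k n)
subsets-unique zero    zero    = [] ∷ []
subsets-unique (suc k) zero    = []
subsets-unique zero    (suc n) = map⁺ ∷-injectiveʳ (subsets-unique zero n)
subsets-unique (suc k) (suc n) = ++⁺ (map⁺ ∷-injectiveʳ (subsets-unique k n)) (map⁺ ∷-injectiveʳ (subsets-unique (suc k) n))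
  λ (i , j) → case ∈-map⁻ (inside ∷_) i , ∈-map⁻ (outside ∷_) j of λ { ((_ , _ , refl) , (_ , _ , ())) }

subsets-card : ∀ k n {s} → s ∈ subsets k n → ∣ s ∣ ≡ k
subsets-card zero    zero    (here refl) = refl
subsets-card zero    (suc n) i with _ , j , refl ← ∈-map⁻ (outside ∷_) i = subsets-card zero n j
subsets-card (suc k) (suc n) i with ∈-++⁻ (map (inside ∷_) (subsets k n)) i
... | inj₁ j with _ , j′ , refl ← ∈-map⁻ (inside ∷_) j = cong suc (subsets-card k n j′)
... | inj₂ j with _ , j′ , refl ← ∈-map⁻ (outside ∷_) j = subsets-card (suc k) n j′

toSet : ∀ {n} → List (Fin n) → Subset n
toSet = foldr (λ x s → s [ x ]≔ inside) ∅

toSet-map-suc : ∀ {n} (l : List (Fin n)) → toSet (map suc l) ≡ outside ∷ toSet l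
toSet-map-suc []      = refl
toSet-map-suc (x ∷ l) rewrite toSet-map-suc l = refl

∈-toSet : ∀ {n} {x : Fin n} {l} → x ∈ l → x ∈ˢ toSet l
∈-toSet {x = x} {_ ∷ l} (here refl) = []≔-updates (toSet l) x
∈-toSet {x = x} {y ∷ l} (there i) with x ≟ᶠ y
... | yes refl = []≔-updates (toSet l) x
... | no  x≢y  = []≔-minimal (toSet l) x y x≢y (∈-toSet i)

-- Connects the two encodings of 4-sets: bit vectors, which are coloured and matched, and sublists
-- of vertices, on which all counting is done.
count-subsets : ∀ k n (p : Subset n → Bool) → count p (subsets k n) ≡ ∑ k (λ l → ι (p (toSet l))) (allFin n)
count-subsets zero    zero    p = +-identityʳ _
count-subsets (suc k) zero    p = refl
count-subsets zero    (suc n) p = ≡-trans (count-map p (outside ∷_) (subsets zero n)) (count-subsets zero n (p ∘ (outside ∷_)))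
count-subsets (suc k) (suc n) p = begin
  count p (map (inside ∷_) (subsets k n) ++ map (outside ∷_) (subsets (suc k) n))
    ≡⟨ count-++ p (map (inside ∷_) (subsets k n)) _ ⟩
  count p (map (inside ∷_) (subsets k n)) + count p (map (outside ∷_) (subsets (suc k) n))
    ≡⟨ cong₂ _+_ (count-map p (inside ∷_) (subsets k n)) (count-map p (outside ∷_) (subsets (suc k) n)) ⟩
  count (p ∘ (inside ∷_)) (subsets k n) + count (p ∘ (outside ∷_)) (subsets (suc k) n)
    ≡⟨ cong₂ _+_ (count-subsets k n (p ∘ (inside ∷_))) (count-subsets (suc k) n (p ∘ (outside ∷_))) ⟩
  ∑ k (λ l → ι (p (inside ∷ toSet l))) (allFin n) + ∑ (suc k) (λ l → ι (p (outside ∷ toSet l))) (allFin n)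
    ≡⟨ cong₂ _+_ (∑-cong k (allFin n) λ l → cong (λ s → ι (p (s [ zero ]≔ inside))) (toSet-map-suc l))
                 (∑-cong (suc k) (allFin n) λ l → cong (ι ∘ p) (toSet-map-suc l)) ⟨
  ∑ k (λ l → ι (p (toSet (zero ∷ map suc l)))) (allFin n) + ∑ (suc k) (λ l → ι (p (toSet (map suc l)))) (allFin n)
    ≡⟨ cong₂ _+_ (∑-map k _ suc (allFin n)) (∑-map (suc k) _ suc (allFin n)) ⟨
  ∑ (suc k) (λ l → ι (p (toSet l))) (zero ∷ map suc (allFin n))
    ≡⟨ cong (λ l → ∑ (suc k) (λ l → ι (p (toSet l))) (zero ∷ l)) (List.map-tabulate (λ i → i) suc) ⟩
  ∑ (suc k) (λ l → ι (p (toSet l))) (allFin (suc n)) ∎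
  where open ≡-Reasoning

pairsOf : List V → List (V × V)
pairsOf []       = []
pairsOf (x ∷ xs) = map (x ,_) xs ++ pairsOf xs

∈-pairsOf : ∀ {x y : V} {xs} → (x , y) ∈ pairsOf xs → x ∈ xs × y ∈ xs
∈-pairsOf {xs = z ∷ zs} i with ∈-++⁻ (map (z ,_) zs) i
... | inj₁ j with _ , j′ , refl ← ∈-map⁻ (z ,_) j = here refl , there j′
... | inj₂ j = let a , b = ∈-pairsOf j in there a , there b

∈-pairsOf-tabulate : ∀ {t} (φ : Fin t → V) {i j} → i <ᶠ j → (φ i , φ j) ∈ pairsOf (tabulate φ)
∈-pairsOf-tabulate φ {zero}  {suc j} _       = ∈-++⁺ˡ (∈-map⁺ (φ zero ,_) (∈-tabulate⁺ j))
∈-pairsOf-tabulate φ {suc i} {suc j} (s≤s p) = ∈-++⁺ʳ (map (φ zero ,_) (tabulate (φ ∘ suc))) (∈-pairsOf-tabulate (φ ∘ suc) p)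

does-true : ∀ {P : Set} (d : Dec P) → does d ≡ true → P
does-true (yes p) _ = p

module _ {n : ℕ} (A : Fin n × Fin n → Bool) where

  symmetrise : Graph (Fin n)
  symmetrise .adj x y = not (does (x ≟ᶠ y)) ∧ (A (x , y) ∨ A (y , x))
  symmetrise .symm {x} {y} e with x ≟ᶠ y | y ≟ᶠ x
  ... | no _ | no _     = [ ∨-introʳ {A (y , x)} , ∨-introˡ ]′ (∨-true {A (x , y)} e)
  ... | no n | yes refl = ⊥-elim (n refl)
  symmetrise .irrefl {x} e with x ≟ᶠ x
  ... | no n = n refl

  -- `pairsOf` lists each pair in one order only, so symmetrising merges no two members of `A`.
  count-pairsOf : ∀ {xs} → Unique xs → count A (pairsOf xs) ≤ size symmetrise xs
  count-pairsOf [] = z≤n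
  count-pairsOf {x ∷ xs} (x∉ ∷ u) = begin
    count A (map (x ,_) xs ++ pairsOf xs)          ≡⟨ count-++ A (map (x ,_) xs) _ ⟩
    count A (map (x ,_) xs) + count A (pairsOf xs) ≡⟨ cong (_+ count A (pairsOf xs)) (count-map A (x ,_) xs) ⟩
    count (λ y → A (x , y)) xs + count A (pairsOf xs) ≤⟨ +-mono-≤ (row xs x∉) (count-pairsOf u) ⟩
    deg symmetrise x xs + size symmetrise xs       ∎
    where
    open ≤-Reasoning
    row : ∀ ys → All (x ≢_) ys → count (λ y → A (x , y)) ys ≤ deg symmetrise x ys
    row []       []       = z≤n
    row (y ∷ ys) (n ∷ ns) = +-mono-≤ (ι-mono λ e → edge-touches symmetrise (edge e)) (row ys ns)
      where
      edge : A (x , y) ≡ true → adj symmetrise x y ≡ true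
      edge e with x ≟ᶠ y
      ... | yes p = ⊥-elim (n p)
      ... | no _  = ∨-introˡ e

module _ {n : ℕ} (c : Colouring n) (col : Bool) where

  coloured : Subset n → Bool
  coloured s = does (c s ≟ᵇ col)

  hits : Graph (Fin n) → ℕ
  hits G = ∑ 4 (λ l → ι (coloured (toSet l) ∧ touch G l)) (allFin n)

  record Deficient (vs : List (Fin n)) : Set where
    constructor deficient
    field
      graph : Graph (Fin n)
      few   : hits graph < size graph (allFin n)
      inner : ∀ {x y} → adj graph x y ≡ true → x ∈ vs × y ∈ vs

  module _ {t} (φ : Fin t → Fin n) (φ-injective : Injective _≡_ _≡_ φ) where

    private
      Xs : List (Fin n × Fin n)
      Xs = pairsOf (tabulate φ)

      -- The colour is made part of the adjacency; the right-hand side for Hall's theorem is then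
      -- all of `subsets 4 n`, to which `count-subsets` applies.
      contains : Fin n × Fin n → Subset n → Bool
      contains (x , y) s = coloured s ∧ (does (x ∈ˢ? s) ∧ does (y ∈ˢ? s))

      contains-true : ∀ {x y s} → contains (x , y) s ≡ true → c s ≡ col × x ∈ˢ s × y ∈ˢ s
      contains-true {x} {y} {s} e with a , b ← ∧-true {coloured s} e with b₁ , b₂ ← ∧-true {does (x ∈ˢ? s)} b =
        does-true (c s ≟ᵇ col) a , does-true (x ∈ˢ? s) b₁ , does-true (y ∈ˢ? s) b₂

      open Hall (Product.≡-dec _≟ᶠ_ _≟ᶠ_) ∅ contains Xs
      open DecMembership (Product.≡-dec (_≟ᶠ_ {n}) (_≟ᶠ_ {n})) using (_∈?_)

      -- Membership in `Xs`, instead of the constant `true`, forces a violator to consist of pairs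
      -- of chosen vertices; this gives the field `inner`.
      L : Fin n × Fin n → Bool
      L x = does (x ∈? Xs)

      berge : Matching L (subsets 4 n) → HasBergeK t n c col
      berge (matching f f∈ f-adj f-inj) = φ , (λ i j → f (φ i , φ j)) , φ-injective , edges , distinct
        where
        L-true : ∀ {x} → x ∈ Xs → L x ≡ true
        L-true {x} i = dec-true (x ∈? Xs) i
        edges : ∀ i j → i <ᶠ j → ∣ f (φ i , φ j) ∣ ≡ 4 × c (f (φ i , φ j)) ≡ col × φ i ∈ˢ f (φ i , φ j) × φ j ∈ˢ f (φ i , φ j)
        edges i j p = let m = ∈-pairsOf-tabulate φ p in
          subsets-card 4 n (f∈ m (L-true m)) , contains-true {φ i} {φ j} (f-adj m (L-true m))
        distinct : ∀ i j k l → i <ᶠ j → k <ᶠ l → f (φ i , φ j) ≡ f (φ k , φ l) → i ≡ k × j ≡ l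
        distinct i j k l p q e =
          let m = ∈-pairsOf-tabulate φ p
              m′ = ∈-pairsOf-tabulate φ q
              same = f-inj m m′ (L-true m) (L-true m′) e
          in φ-injective (cong proj₁ same) , φ-injective (cong proj₂ same)

      violates : Violator L (subsets 4 n) → Deficient (tabulate φ)
      violates (violator A A⊆L d) = deficient G few inner
        where
        G = symmetrise A
        inner′ : ∀ {x y} → A (x , y) ≡ true → (x , y) ∈ Xs
        inner′ {x} {y} e = does-true ((x , y) ∈? Xs) (A⊆L e)
        G-true : ∀ {x y} → adj G x y ≡ true → A (x , y) ≡ true ⊎ A (y , x) ≡ true
        G-true {x} {y} e = ∨-true (proj₂ (∧-true {not (does (x ≟ᶠ y))} e))
        inner : ∀ {x y} → adj G x y ≡ true → x ∈ tabulate φ × y ∈ tabulate φ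
        inner e with G-true e
        ... | inj₁ a = ∈-pairsOf (inner′ a)
        ... | inj₂ a = let p , q = ∈-pairsOf (inner′ a) in q , p
        hit : ∀ l → coloured (toSet l) ∧ touch G l ≡ true → N A (toSet l) ≡ true
        hit l e with a , b ← ∧-true {coloured (toSet l)} e with x , y , i , j , xy ← touch-true G {l} b with G-true xy
        ... | inj₁ p = any-intro _ (inner′ p) (∧-intro p (∧-intro a (∧-intro (dec-true (x ∈ˢ? toSet l) (∈-toSet i)) (dec-true (y ∈ˢ? toSet l) (∈-toSet j)))))
        ... | inj₂ p = any-intro _ (inner′ p) (∧-intro p (∧-intro a (∧-intro (dec-true (y ∈ˢ? toSet l) (∈-toSet j)) (dec-true (x ∈ˢ? toSet l) (∈-toSet i)))))
        unique-φ : Unique (tabulate φ)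
        unique-φ = tabulate⁺ φ-injective
        few : hits G < size G (allFin n)
        few = begin-strict
          hits G                                         ≤⟨ ∑-mono 4 (allFin n) (λ l → ι-mono (hit l)) ⟩
          ∑ 4 (λ l → ι (N A (toSet l))) (allFin n)       ≡⟨ count-subsets 4 n (N A) ⟨
          count (N A) (subsets 4 n)                      <⟨ d ⟩
          count A Xs                                     ≤⟨ count-pairsOf A unique-φ ⟩
          size G (tabulate φ)                            ≤⟨ ∑-≤-++ 2 _ (tabulate φ) (proj₁ rest) ⟩
          size G (tabulate φ ++ proj₁ rest)              ≡⟨ ∑-↭ 2 (Symmetric-touch G) (proj₂ rest) ⟨
          size G (allFin n)                              ∎
          where
          open ≤-Reasoning
          rest = extract unique-φ (λ _ → ∈-allFin _)

    berge⊎deficient : HasBergeK t n c col ⊎ Deficient (tabulate φ)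
    berge⊎deficient = [ inj₁ ∘ berge , inj₂ ∘ violates ]′ (hall (subsets-unique 4 n) L)

-- Stars and unions of deficient graphs

_∪ᴳ_ : Graph V → Graph V → Graph V
(G ∪ᴳ H) .adj x y = adj G x y ∨ adj H x y
(G ∪ᴳ H) .symm {x} {y} e = [ ∨-introˡ ∘ symm G , ∨-introʳ {adj G y x} ∘ symm H ]′ (∨-true {adj G x y} e)
(G ∪ᴳ H) .irrefl {x} e = [ irrefl G , irrefl H ]′ (∨-true {adj G x x} e)

touch-∪ : ∀ (G H : Graph V) l → touch (G ∪ᴳ H) l ≡ true → touch G l ≡ true ⊎ touch H l ≡ true
touch-∪ G H l e with x , y , i , j , xy ← touch-true (G ∪ᴳ H) {l} e with ∨-true {adj G x y} xy
... | inj₁ p = inj₁ (touch-intro G l i j p)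
... | inj₂ p = inj₂ (touch-intro H l i j p)

size-∪-upper : ∀ (G H : Graph V) xs → size (G ∪ᴳ H) xs ≤ size G xs + size H xs
size-∪-upper G H xs = ≤-trans (∑-mono 2 xs λ l → ι-⊎ (touch-∪ G H l)) (≤-reflexive (∑-+ 2 _ _ xs))
  where
  ι-⊎ : ∀ {a b c} → (a ≡ true → b ≡ true ⊎ c ≡ true) → ι a ≤ ι b + ι c
  ι-⊎ {false} h = z≤n
  ι-⊎ {true} {b} h with h refl
  ... | inj₁ refl = m≤m+n 1 _
  ... | inj₂ refl = m≤n+m 1 (ι b)

size-∪-lower : ∀ (G H : Graph V) xs → (∀ {x y} → adj G x y ≡ true → ¬ adj H x y ≡ true) →
               size G xs + size H xs ≤ size (G ∪ᴳ H) xs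
size-∪-lower G H xs disjoint = ≤-trans (≤-reflexive (sym (∑-+ 2 _ _ xs))) (∑-mono-length 2 xs λ where
  (x ∷ y ∷ []) refl → pointwise (adj G x y) (adj H x y) disjoint)
  where
  pointwise : ∀ a b → (a ≡ true → ¬ b ≡ true) → ι ((a ∨ false) ∨ false) + ι ((b ∨ false) ∨ false) ≤ ι (((a ∨ b) ∨ false) ∨ false)
  pointwise true  true  d = ⊥-elim (d refl refl)
  pointwise true  false d = ≤-refl
  pointwise false b     d = ≤-refl

Star : Graph V → V → Set
Star G z = ∀ {x y} → adj G x y ≡ true → x ≡ z ⊎ y ≡ z

module _ {n : ℕ} (G : Graph (Fin n)) where

  edge-avoiding? : ∀ z → (∃[ x ] ∃[ y ] adj G x y ≡ true × x ≢ z × y ≢ z) ⊎ Star G z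
  edge-avoiding? z with Fin.any? (λ x → Fin.any? (λ y → (adj G x y ≟ᵇ true) ×-dec (¬? (x ≟ᶠ z) ×-dec ¬? (y ≟ᶠ z))))
  ... | yes p = inj₁ p
  ... | no ¬p = inj₂ λ {x} {y} e → case x ≟ᶠ z of λ where
    (yes x≡z) → inj₁ x≡z
    (no x≢z)  → case y ≟ᶠ z of λ where
      (yes y≡z) → inj₂ y≡z
      (no y≢z)  → ⊥-elim (¬p (x , y , e , x≢z , y≢z))

  private
    loop-free : ∀ {x y} → adj G x y ≡ true → x ≢ y
    loop-free e refl = irrefl G e

  two-edges : ∀ {x y a b} → adj G x y ≡ true → adj G a b ≡ true → x ≢ a → x ≢ b → y ≢ a → y ≢ b → NonStar G (allFin n)
  two-edges xy ab xa xb ya yb = nonStar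
    ((loop-free xy ∷ xa ∷ xb ∷ []) ∷ (ya ∷ yb ∷ []) ∷ (loop-free ab ∷ []) ∷ [] ∷ []) (λ _ → ∈-allFin _) (2K₂ xy ab)

  private
    -- Edge vb avoids u and edge ud avoids v: they are disjoint, or close a triangle on uv.
    close : ∀ {u v b d} → adj G u v ≡ true → adj G v b ≡ true → b ≢ u → adj G u d ≡ true → d ≢ v → NonStar G (allFin n)
    close {u} {v} {b} {d} uv vb b≢u ud d≢v with b ≟ᶠ d
    ... | no b≢d = two-edges vb ud (≢-sym (loop-free uv)) (≢-sym d≢v) b≢u b≢d
    ... | yes refl = nonStar ((loop-free uv ∷ loop-free ud ∷ []) ∷ (loop-free vb ∷ []) ∷ [] ∷ []) (λ _ → ∈-allFin _) (K₃ uv ud vb)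

    close′ : ∀ {u v b c d} → adj G u v ≡ true → adj G v b ≡ true → b ≢ u →
             adj G c d ≡ true → c ≢ v → d ≢ v → NonStar G (allFin n)
    close′ {u} {v} {b} {c} {d} uv vb b≢u cd c≢v d≢v with c ≟ᶠ u | d ≟ᶠ u
    ... | yes refl | _        = close uv vb b≢u cd d≢v
    ... | no _     | yes refl = close uv vb b≢u (symm G cd) c≢v
    ... | no c≢u   | no d≢u   = two-edges uv cd (≢-sym c≢u) (≢-sym d≢u) (≢-sym c≢v) (≢-sym d≢v)

  -- A centre has to be an end of `uv`. If neither end is one, some edge avoids `u` and some edge
  -- avoids `v`. Either one of them is disjoint from `uv`, or the first starts at `v` and the second
  -- at `u`, and these are disjoint or close a triangle.
  nonStar⊎star : ∀ {u v} → adj G u v ≡ true → NonStar G (allFin n) ⊎ ∃ (Star G)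
  nonStar⊎star {u} {v} uv with edge-avoiding? u | edge-avoiding? v
  ... | inj₂ s | _ = inj₂ (u , s)
  ... | inj₁ _ | inj₂ s = inj₂ (v , s)
  ... | inj₁ (a , b , ab , a≢u , b≢u) | inj₁ (c , d , cd , c≢v , d≢v) with a ≟ᶠ v | b ≟ᶠ v
  ...   | yes refl | _        = inj₁ (close′ uv ab b≢u cd c≢v d≢v)
  ...   | no _     | yes refl = inj₁ (close′ uv (symm G ab) a≢u cd c≢v d≢v)
  ...   | no a≢v   | no b≢v   = inj₁ (two-edges uv ab (≢-sym a≢u) (≢-sym b≢u) (≢-sym a≢v) (≢-sym b≢v))

  nonempty : 0 < size G (allFin n) → ∃[ x ] ∃[ y ] adj G x y ≡ true
  nonempty p with l , _ , q ← ∑-pos 2 _ (allFin n) p with x , y , _ , _ , e ← touch-true G {l} (ι-pos q) = x , y , e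

  module _ {vs : List (Fin n)} (uq : Unique vs) (inner : ∀ {x y} → adj G x y ≡ true → x ∈ vs × y ∈ vs) where

    private
      absent : ∀ {x y} → ¬ adj G x y ≡ true → adj G x y ≡ false
      absent {x} {y} h with true? (adj G x y)
      ... | inj₁ e = ⊥-elim (h e)
      ... | inj₂ e = e

    size-inner : size G (allFin n) ≤ size G vs
    size-inner with extract uq (λ _ → ∈-allFin _)
    ... | ds , p = ≤-trans (≤-reflexive (∑-↭ 2 (Symmetric-touch G) p)) (size-++ G vs ds λ _ j → absent λ e → unique-++-disjoint unique-++ (proj₂ (inner e)) j)
      where
      unique-++ : Unique (vs ++ ds)
      unique-++ = Unique-resp-↭ (setoid (Fin n)) (↭⇒↭ₛ p) (allFin⁺ n)

    star-size : ∀ {z} → Star G z → size G (allFin n) ≤ length vs ∸ 1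
    star-size {z} star with DecMembership._∈?_ _≟ᶠ_ z vs
    ... | no z∉ = ≤-trans size-inner (≤-trans (size-++ G [] vs λ _ _ → absent λ e →
                    [ (λ { refl → z∉ (proj₁ (inner e)) }) , (λ { refl → z∉ (proj₂ (inner e)) }) ]′ (star e)) z≤n)
    ... | yes z∈ with ∈-extract z∈
    ...   | ws , p = begin
      size G (allFin n)        ≤⟨ size-inner ⟩
      size G vs                ≡⟨ ∑-↭ 2 (Symmetric-touch G) p ⟩
      deg G z ws + size G ws   ≤⟨ +-mono-≤ (deg≤length G z ws) (size-++ G [] ws none) ⟩
      length ws + 0            ≡⟨ +-identityʳ _ ⟩
      length ws                ≡⟨ cong (_∸ 1) (↭-length p) ⟨
      length vs ∸ 1            ∎
      where
      open ≤-Reasoning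
      z∉ws : ¬ z ∈ ws
      z∉ws i = lookup (AllPairs.head (Unique-resp-↭ (setoid (Fin n)) (↭⇒↭ₛ p) uq)) i refl
      none : ∀ {s t} → s ∈ [] ++ ws → t ∈ ws → adj G s t ≡ false
      none i j = absent λ e → [ (λ { refl → z∉ws i }) , (λ { refl → z∉ws j }) ]′ (star e)

module _ {n : ℕ} (c : Colouring n) (col : Bool) where

  hits-∪ : ∀ G H → hits c col (G ∪ᴳ H) ≤ hits c col G + hits c col H
  hits-∪ G H = ≤-trans (∑-mono 4 (allFin n) λ l → pointwise l (coloured c col (toSet l))) (≤-reflexive (∑-+ 4 _ _ (allFin n)))
    where
    pointwise : ∀ l b → ι (b ∧ touch (G ∪ᴳ H) l) ≤ ι (b ∧ touch G l) + ι (b ∧ touch H l)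
    pointwise l false = z≤n
    pointwise l true with touch (G ∪ᴳ H) l in eq
    ... | false = z≤n
    ... | true with touch-∪ G H l eq
    ...   | inj₁ p rewrite p = m≤m+n 1 _
    ...   | inj₂ p rewrite p = m≤n+m 1 (ι (touch G l))

  ∪-deficient : ∀ G H → hits c col G < size G (allFin n) → hits c col H < size H (allFin n) →
                (∀ {x y} → adj G x y ≡ true → ¬ adj H x y ≡ true) →
                hits c col (G ∪ᴳ H) < size (G ∪ᴳ H) (allFin n)
  ∪-deficient G H g h d = begin-strict
    hits c col (G ∪ᴳ H)                       ≤⟨ hits-∪ G H ⟩
    hits c col G + hits c col H               <⟨ +-mono-< g h ⟩
    size G (allFin n) + size H (allFin n)     ≤⟨ size-∪-lower G H (allFin n) d ⟩
    size (G ∪ᴳ H) (allFin n)                  ∎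
    where open ≤-Reasoning

  -- The bound on the size serves the smallest cases: `sparse₇` requires at most 18 edges, and the
  -- count on six vertices at most 6.
  record NonStarDeficient (bound : ℕ) : Set where
    constructor nonStarDeficient
    field
      graph   : Graph (Fin n)
      few     : hits c col graph < size graph (allFin n)
      bounded : size graph (allFin n) ≤ bound
      spread  : NonStar graph (allFin n)

  ∪-bounded : ∀ {a b} (G H : Graph (Fin n)) → size G (allFin n) ≤ a → size H (allFin n) ≤ b → size (G ∪ᴳ H) (allFin n) ≤ a + b
  ∪-bounded G H g h = ≤-trans (size-∪-upper G H (allFin n)) (+-mono-≤ g h)

star-disjoint : ∀ {G H : Graph V} {z} → Star G z → (∀ {x y} → adj H x y ≡ true → x ≢ z × y ≢ z) →
                ∀ {x y} → adj G x y ≡ true → ¬ adj H x y ≡ true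
star-disjoint s a g h with s g
... | inj₁ p = proj₁ (a h) p
... | inj₂ p = proj₂ (a h) p

on-edge : ∀ {a b z x y : V} → a ≢ b → x ≡ a ⊎ y ≡ a → x ≡ b ⊎ y ≡ b → x ≡ z ⊎ y ≡ z → z ≡ a ⊎ z ≡ b
on-edge a≢b (inj₁ refl) (inj₁ refl) _ = ⊥-elim (a≢b refl)
on-edge a≢b (inj₂ refl) (inj₂ refl) _ = ⊥-elim (a≢b refl)
on-edge a≢b (inj₁ refl) (inj₂ refl) (inj₁ refl) = inj₁ refl
on-edge a≢b (inj₁ refl) (inj₂ refl) (inj₂ refl) = inj₂ refl
on-edge a≢b (inj₂ refl) (inj₁ refl) (inj₁ refl) = inj₂ refl
on-edge a≢b (inj₂ refl) (inj₁ refl) (inj₂ refl) = inj₁ refl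

-- A deficient star with centre z is joined to a deficient graph avoiding z; at most two such steps are needed.
module _ {t : ℕ} (c : Colouring (suc t)) (col : Bool) where

  spread-deficient : ((w : Fin (suc t)) → Deficient c col (tabulate (punchIn w))) →
                     NonStarDeficient c col (tri t ⊔ 3 * (t ∸ 1))
  spread-deficient D = step₁
    where
    vs : List (Fin (suc t))
    vs = allFin (suc t)
    E : Fin (suc t) → Graph (Fin (suc t))
    E w = Deficient.graph (D w)
    few : ∀ w → hits c col (E w) < size (E w) vs
    few w = Deficient.few (D w)
    support : Fin (suc t) → List (Fin (suc t))
    support w = tabulate (punchIn w)
    unique-support : ∀ w → Unique (support w)
    unique-support w = tabulate⁺ (Fin.punchIn-injective w _ _)
    length-support : ∀ w → length (support w) ≡ t
    length-support w = List.length-tabulate (punchIn w)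
    avoids : ∀ w {x y} → adj (E w) x y ≡ true → x ≢ w × y ≢ w
    avoids w e = let i , j = Deficient.inner (D w) e in missing i , missing j
      where
      missing : ∀ {x} → x ∈ support w → x ≢ w
      missing i q with k , p ← ∈-tabulate⁻ i = Fin.punchInᵢ≢i w k (≡-trans (sym p) q)
    edge : ∀ w → ∃[ x ] ∃[ y ] adj (E w) x y ≡ true
    edge w = nonempty (E w) (≤-trans (s≤s z≤n) (few w))
    star-bound : ∀ w {z} → Star (E w) z → size (E w) vs ≤ t ∸ 1
    star-bound w s = subst (λ k → size (E w) vs ≤ k ∸ 1) (length-support w) (star-size (E w) (unique-support w) (Deficient.inner (D w)) s)
    done : ∀ w → NonStar (E w) vs → NonStarDeficient c col (tri t ⊔ 3 * (t ∸ 1))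
    done w ns = nonStarDeficient (E w) (few w) (≤-trans (size-inner (E w) (unique-support w) (Deficient.inner (D w)))
      (≤-trans (subst (λ k → size (E w) (support w) ≤ tri k) (length-support w) (size≤tri (E w) (support w))) (m≤m⊔n _ _))) ns
    -- At most three stars with at most `t ∸ 1` edges each are united, whence the second term of the
    -- bound. For `t = 6` both terms are 15, within the 18 edges that `sparse₇` admits.
    small : ∀ {k} → k ≤ 3 * (t ∸ 1) → k ≤ tri t ⊔ 3 * (t ∸ 1)
    small p = ≤-trans p (m≤n⊔m _ _)

    step₃ : ∀ z₁ z₂ z → Star (E zero) z₁ → Star (E z₁) z₂ → Star (E zero ∪ᴳ E z₁) z → NonStarDeficient c col (tri t ⊔ 3 * (t ∸ 1))
    step₃ z₁ z₂ z s₁ s₂ s with nonStar⊎star (E z) (proj₂ (proj₂ (edge z)))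
    ... | inj₁ ns = done z ns
    ... | inj₂ (_ , s₃) with nonStar⊎star (U ∪ᴳ E z) (∨-introˡ {adj U x₁ y₁} (∨-introˡ e₁))
      where
      U = E zero ∪ᴳ E z₁
      x₁ = proj₁ (edge zero)
      y₁ = proj₁ (proj₂ (edge zero))
      e₁ = proj₂ (proj₂ (edge zero))
    ...   | inj₁ ns = nonStarDeficient (U ∪ᴳ E z)
              (∪-deficient c col U (E z) (∪-deficient c col (E zero) (E z₁) (few zero) (few z₁) (star-disjoint {G = E zero} {E z₁} s₁ (avoids z₁)))
                 (few z) (star-disjoint {G = U} {E z} s (avoids z)))
              (small (≤-trans (∪-bounded c col U (E z) (∪-bounded c col (E zero) (E z₁) (star-bound zero s₁) (star-bound z₁ s₂)) (star-bound z s₃))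
                 (≤-reflexive (three (t ∸ 1))))) ns
      where
      U = E zero ∪ᴳ E z₁
      three : ∀ k → k + k + k ≡ 3 * k
      three = solve-∀
    -- Since `E z` avoids `z`, the centre `z′` differs from `z`, so all edges of `E zero ∪ᴳ E z₁`
    -- join `z` and `z′`. The one from `E zero` contains `z₁`, so `z₁` is `z` or `z′`; but the one
    -- from `E z₁` avoids `z₁`.
    ...   | inj₂ (z′ , s′) with x₁ , y₁ , e₁ ← edge zero with x₂ , y₂ , e₂ ← edge z₁ with x₃ , y₃ , e₃ ← edge z =
      ⊥-elim ([ contra (s e₂′) , contra (s′ (∨-introˡ e₂′)) ]′ (on-edge z≢z′ (s e₁′) (s′ (∨-introˡ e₁′)) (s₁ e₁)))
      where
      e₁′ : adj (E zero ∪ᴳ E z₁) x₁ y₁ ≡ true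
      e₁′ = ∨-introˡ e₁
      e₂′ : adj (E zero ∪ᴳ E z₁) x₂ y₂ ≡ true
      e₂′ = ∨-introʳ {adj (E zero) x₂ y₂} e₂
      z≢z′ : z ≢ z′
      z≢z′ refl = [ proj₁ (avoids z e₃) , proj₂ (avoids z e₃) ]′ (s′ (∨-introʳ {adj (E zero ∪ᴳ E z₁) x₃ y₃} e₃))
      contra : ∀ {w} → x₂ ≡ w ⊎ y₂ ≡ w → z₁ ≡ w → ⊥
      contra p refl = [ proj₁ (avoids z₁ e₂) , proj₂ (avoids z₁ e₂) ]′ p

    step₂ : ∀ z₁ → Star (E zero) z₁ → NonStarDeficient c col (tri t ⊔ 3 * (t ∸ 1))
    step₂ z₁ s₁ with nonStar⊎star (E z₁) (proj₂ (proj₂ (edge z₁)))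
    ... | inj₁ ns = done z₁ ns
    ... | inj₂ (z₂ , s₂) with nonStar⊎star (E zero ∪ᴳ E z₁) (∨-introˡ (proj₂ (proj₂ (edge zero))))
    ...   | inj₁ ns = nonStarDeficient (E zero ∪ᴳ E z₁)
              (∪-deficient c col (E zero) (E z₁) (few zero) (few z₁) (star-disjoint {G = E zero} {E z₁} s₁ (avoids z₁)))
              (small (≤-trans (∪-bounded c col (E zero) (E z₁) (star-bound zero s₁) (star-bound z₁ s₂)) (+-monoʳ-≤ (t ∸ 1) (m≤m+n _ _)))) ns
    ...   | inj₂ (z , s) = step₃ z₁ z₂ z s₁ s₂ s

    step₁ : NonStarDeficient c col (tri t ⊔ 3 * (t ∸ 1))
    step₁ with nonStar⊎star (E zero) (proj₂ (proj₂ (edge zero)))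
    ... | inj₁ ns = done zero ns
    ... | inj₂ (z₁ , s₁) = step₂ z₁ s₁

-- Upper bounds

-- Each common 4-set has one of the two colours and is therefore a hit of `A` or of `B`, while both
-- numbers of hits are smaller than the sizes.
meet⇒⊥ : ∀ {n} (c : Colouring n) (A B : Graph (Fin n)) → hits c true A < size A (allFin n) →
         hits c false B < size B (allFin n) → ¬ Meet A B (allFin n)
meet⇒⊥ {n} c A B a b m = <-irrefl refl (begin-strict
  size A (allFin n) + size B (allFin n)       ≤⟨ m ⟩
  suc (common 4 A B (allFin n))               ≤⟨ s≤s cover ⟩
  suc (hits c true A + hits c false B)        <⟨ n<1+n _ ⟩
  2 + (hits c true A + hits c false B)        ≡⟨ cong suc (+-suc (hits c true A) _) ⟨
  suc (hits c true A) + suc (hits c false B)  ≤⟨ +-mono-≤ a b ⟩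
  size A (allFin n) + size B (allFin n)       ∎)
  where
  open ≤-Reasoning
  pointwise : ∀ col a b → ι (a ∧ b) ≤ ι (does (col ≟ᵇ true) ∧ a) + ι (does (col ≟ᵇ false) ∧ b)
  pointwise true  true  b = ≤-trans (ι≤1 b) (m≤m+n 1 _)
  pointwise false true  b = ≤-refl
  pointwise col   false b = z≤n
  cover : common 4 A B (allFin n) ≤ hits c true A + hits c false B
  cover = ≤-trans (∑-mono 4 (allFin n) λ l → pointwise (c (toSet l)) (touch A l) (touch B l)) (≤-reflexive (∑-+ 4 _ _ (allFin n)))

choose : ∀ {n} {P : Set} {Q : Fin n → Set} → (∀ w → P ⊎ Q w) → P ⊎ (∀ w → Q w)
choose {zero}  f = inj₂ λ ()
choose {suc n} f with f zero | choose (f ∘ suc)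
... | inj₁ p | _      = inj₁ p
... | inj₂ _ | inj₁ p = inj₁ p
... | inj₂ q | inj₂ g = inj₂ λ { zero → q ; (suc w) → g w }

length-allFin : ∀ n → length (allFin n) ≡ n
length-allFin n = List.length-tabulate {n = n} (λ i → i)

arrows-from : ∀ {t n b} → (∀ c col → HasBergeK t n c col ⊎ NonStarDeficient c col b) →
              (∀ (A B : Graph (Fin n)) → NonStar A (allFin n) → NonStar B (allFin n) →
                 size A (allFin n) ≤ b → size B (allFin n) ≤ b → Meet A B (allFin n)) → Arrows t n
arrows-from f meets c with f c true | f c false
... | inj₁ B | _      = inj₁ B
... | inj₂ _ | inj₁ B = inj₂ B
... | inj₂ (nonStarDeficient G g gb gs) | inj₂ (nonStarDeficient H h hb hs) =
  ⊥-elim (meet⇒⊥ c G H g h (meets G H gs hs gb hb))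

arrows-suc : ∀ t → 6 ≤ t → Arrows t (suc t)
arrows-suc t 6≤t = arrows-from
  (λ c col → [ inj₁ , (λ D → inj₂ (spread-deficient c col D)) ]′
    (choose λ w → berge⊎deficient c col (punchIn w) (Fin.punchIn-injective w _ _)))
  (subst (λ t → ∀ (A B : Graph (Fin (suc t))) → NonStar A (allFin (suc t)) → NonStar B (allFin (suc t)) →
            size A (allFin (suc t)) ≤ tri t ⊔ 3 * (t ∸ 1) → size B (allFin (suc t)) ≤ tri t ⊔ 3 * (t ∸ 1) → Meet A B (allFin (suc t)))
         (m+[n∸m]≡n 6≤t) (meets (t ∸ 6)))
  where
  meets : ∀ k (A B : Graph (Fin (7 + k))) → NonStar A (allFin (7 + k)) → NonStar B (allFin (7 + k)) →
          size A (allFin (7 + k)) ≤ tri (6 + k) ⊔ 3 * (5 + k) → size B (allFin (7 + k)) ≤ tri (6 + k) ⊔ 3 * (5 + k) →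
          Meet A B (allFin (7 + k))
  meets zero    A B nA nB a b = sparse₇ A B refl nA nB (≤-trans a (m≤m+n 15 3)) (≤-trans b (m≤m+n 15 3))
  meets (suc k) A B nA nB _ _ = meet _≟ᶠ_ A B k (allFin (8 + k)) (length-allFin (8 + k)) (allFin⁺ (8 + k)) nA nB

module _ (c : Colouring 6) (col : Bool) where

  private
    φ : Fin 6 → Fin 5 → Fin 4 → Fin 6
    φ w w′ i = punchIn w (punchIn w′ i)

    φ-injective : ∀ w w′ {i j} → φ w w′ i ≡ φ w w′ j → i ≡ j
    φ-injective w w′ e = Fin.punchIn-injective w′ _ _ (Fin.punchIn-injective w _ _ e)

  -- With two vertices to spare one union suffices, because the second graph can avoid both ends of
  -- an edge of the first. The bound 6 is 4 choose 2 for one graph and 3 + 3 for two stars.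
  spread-deficient₄ : (∀ w w′ → Deficient c col (tabulate (φ w w′))) → NonStarDeficient c col 6
  spread-deficient₄ D = result
    where
    E : Fin 6 → Fin 5 → Graph (Fin 6)
    E w w′ = Deficient.graph (D w w′)
    edge : ∀ w w′ → ∃[ x ] ∃[ y ] adj (E w w′) x y ≡ true
    edge w w′ = nonempty (E w w′) (≤-trans (s≤s z≤n) (Deficient.few (D w w′)))
    done : ∀ w w′ → NonStar (E w w′) (allFin 6) → NonStarDeficient c col 6
    done w w′ ns = nonStarDeficient (E w w′) (Deficient.few (D w w′))
      (≤-trans (size-inner (E w w′) (tabulate⁺ (φ-injective w w′)) (Deficient.inner (D w w′)))
               (size≤tri (E w w′) (tabulate (φ w w′)))) ns
    star-bound : ∀ w w′ {z} → Star (E w w′) z → size (E w w′) (allFin 6) ≤ 3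
    star-bound w w′ = star-size (E w w′) (tabulate⁺ (φ-injective w w′)) (Deficient.inner (D w w′))
    missing : ∀ {x y} (x≢y : x ≢ y) {v} → v ∈ tabulate (φ x (punchOut x≢y)) → v ≢ x × v ≢ y
    missing {x} {y} x≢y i with k , refl ← ∈-tabulate⁻ {f = φ x (punchOut x≢y)} i =
      Fin.punchInᵢ≢i x _ ,
      λ e → Fin.punchInᵢ≢i (punchOut x≢y) k (Fin.punchIn-injective x _ _ (≡-trans e (sym (Fin.punchIn-punchOut x≢y))))
    -- An edge xy of a deficient star is disjoint from every edge of a deficient graph avoiding x and y.
    join : ∀ {x y z} → adj (E zero zero) x y ≡ true → Star (E zero zero) z → NonStarDeficient c col 6
    join {x} {y} {z} xy s = go (edge x w′)
      where
      x≢y : x ≢ y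
      x≢y refl = irrefl (E zero zero) xy
      w′ = punchOut x≢y
      avoids : ∀ {a b} → adj (E x w′) a b ≡ true → (a ≢ x × a ≢ y) × (b ≢ x × b ≢ y)
      avoids e = let i , j = Deficient.inner (D x w′) e in missing x≢y i , missing x≢y j
      avoids-z : ∀ {a b} → adj (E x w′) a b ≡ true → a ≢ z × b ≢ z
      avoids-z e with (ax , ay) , (bx , by) ← avoids e with s xy
      ... | inj₁ refl = ax , bx
      ... | inj₂ refl = ay , by
      go : ∃[ a ] ∃[ b ] adj (E x w′) a b ≡ true → NonStarDeficient c col 6
      go (a , b , ab) with nonStar⊎star (E x w′) ab
      ... | inj₁ ns = done x w′ ns
      ... | inj₂ (_ , s′) = nonStarDeficient (E zero zero ∪ᴳ E x w′)
        (∪-deficient c col (E zero zero) (E x w′) (Deficient.few (D zero zero)) (Deficient.few (D x w′))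
          (star-disjoint {G = E zero zero} {E x w′} s avoids-z))
        (∪-bounded c col (E zero zero) (E x w′) (star-bound zero zero s) (star-bound x w′ s′))
        (let (ax , ay) , (bx , by) = avoids ab in
         two-edges (E zero zero ∪ᴳ E x w′) (∨-introˡ xy) (∨-introʳ {adj (E zero zero) a b} ab) (≢-sym ax) (≢-sym bx) (≢-sym ay) (≢-sym by))
    result : NonStarDeficient c col 6
    result with x , y , xy ← edge zero zero with nonStar⊎star (E zero zero) xy
    ... | inj₁ ns = done zero zero ns
    ... | inj₂ (_ , s) = join xy s

  berge⊎spread₄ : HasBergeK 4 6 c col ⊎ NonStarDeficient c col 6
  berge⊎spread₄ = [ inj₁ , inj₂ ∘ spread-deficient₄ ]′
    (choose λ w → choose λ w′ → berge⊎deficient c col (φ w w′) (φ-injective w w′))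

arrows₄ : Arrows 4 6
arrows₄ = arrows-from berge⊎spread₄ λ A B nA nB a b → balanced 8 A B (allFin 6) refl (sum≤8 A nA a) (sum≤8 B nB b)
  where
  sum≤8 : ∀ (G : Graph (Fin 6)) → NonStar G (allFin 6) → size G (allFin 6) ≤ 6 → untouched G 4 (allFin 6) + size G (allFin 6) ≤ 8
  sum≤8 G ns s≤6 = ≤∸⇒+≤
    -- The search runs over graphs of every size, and `8 ∸ k` is too small for some of them: two
    -- vertices joined to everything make nine edges and leave one 4-set without an edge. The cap at
    -- 7 admits it and changes nothing up to 6 edges.
    (≤-trans (nonStar-untouched (λ k → 8 ∸ (7 ⊓ k)) (λ p → ∸-monoʳ-≤ 8 (⊓-monoʳ-≤ 7 p)) G 4 6 refl ns refl refl)
             (≤-reflexive (cong (8 ∸_) (m≥n⇒m⊓n≡n (≤-trans s≤6 (n≤1+n 6))))))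
    (≤-trans s≤6 (m≤m+n 6 2))

-- For t ≤ 3 the single support {2, …, t + 1} suffices.
arrows-direct : ∀ t d → suc (∑ 4 (const 1) (allFin (2 + t))) ≡ d + d →
  (∀ (G : Graph (Fin (2 + t))) → (∀ y → touch G (zero ∷ y ∷ []) ≡ false) → (∀ y → touch G (suc zero ∷ y ∷ []) ≡ false) →
     0 < size G (allFin (2 + t)) → size G (allFin (2 + t)) ≤ tri t → untouched G 4 (allFin (2 + t)) + size G (allFin (2 + t)) ≤ d) →
  Arrows t (2 + t)
arrows-direct t d total bound c with berge⊎deficient c true ss ss-injective | berge⊎deficient c false ss ss-injective
  where
  ss : Fin t → Fin (2 + t)
  ss i = suc (suc i)
  ss-injective : Injective _≡_ _≡_ ss
  ss-injective refl = refl
... | inj₁ B | _      = inj₁ B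
... | inj₂ _ | inj₁ B = inj₂ B
... | inj₂ D | inj₂ D′ = ⊥-elim (meet⇒⊥ c (Deficient.graph D) (Deficient.graph D′) (Deficient.few D) (Deficient.few D′)
    (balanced d (Deficient.graph D) (Deficient.graph D′) (allFin (2 + t)) total (use D) (use D′)))
  where
  use : ∀ {col} (D : Deficient c col (tabulate (λ i → suc (suc i)))) →
        untouched (Deficient.graph D) 4 (allFin (2 + t)) + size (Deficient.graph D) (allFin (2 + t)) ≤ d
  use (deficient G few inner) = bound G (λ y → out (λ j e → 0∉ j e)) (λ y → out (λ j e → 1∉ j e)) (≤-trans (s≤s z≤n) few)
      (≤-trans (size-inner G (tabulate⁺ λ { refl → refl }) inner)
        (≤-trans (size≤tri G (tabulate ss)) (≤-reflexive (cong tri (List.length-tabulate ss)))))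
    where
    ss : Fin t → Fin (2 + t)
    ss i = suc (suc i)
    0∉ : ∀ (j : Fin t) → zero ≢ suc (suc j)
    0∉ j ()
    1∉ : ∀ (j : Fin t) → suc zero ≢ suc (suc j)
    1∉ j ()
    out : ∀ {x y} → (∀ j → x ≢ suc (suc j)) → touch G (x ∷ y ∷ []) ≡ false
    out {x} {y} h with adj G x y in eq
    ... | false = refl
    ... | true with j , p ← ∈-tabulate⁻ {f = λ i → suc (suc i)} (proj₁ (inner eq)) = ⊥-elim (h j p)

arrows₃ : Arrows 3 5
arrows₃ = arrows-direct 3 3 refl λ G o₀ o₁ pos s≤3 → bound (size G (allFin 5)) pos s≤3
  (hinted-untouched h antitone G hints 4 5 {allFin 5} zero refl refl
    (o₀ _ ∷ o₀ _ ∷ o₀ _ ∷ o₀ _ ∷ o₁ _ ∷ o₁ _ ∷ o₁ _ ∷ []) refl)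
  where
  hints : List (List ℕ × Bool)
  hints = (0 ∷ 1 ∷ [] , false) ∷ (0 ∷ 2 ∷ [] , false) ∷ (0 ∷ 3 ∷ [] , false) ∷ (0 ∷ 4 ∷ [] , false)
        ∷ (1 ∷ 2 ∷ [] , false) ∷ (1 ∷ 3 ∷ [] , false) ∷ (1 ∷ 4 ∷ [] , false) ∷ []
  h : ℕ → ℕ
  -- The search includes the empty graph, which avoids all five 4-sets. For `s` edges with `s > 0`
  -- the value is `3 ∸ s`, attained by a single edge.
  h zero    = 5
  h (suc k) = 2 ∸ k
  antitone : ∀ {a b} → a ≤ b → h b ≤ h a
  antitone {zero}  {zero}  _       = ≤-refl
  antitone {zero}  {suc b} _       = ≤-trans (m∸n≤m 2 b) (m≤m+n 2 3)
  antitone {suc a} {suc b} (s≤s p) = ∸-monoʳ-≤ 2 p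
  bound : ∀ {u} s → 0 < s → s ≤ 3 → u ≤ h s → u + s ≤ 3
  bound (suc s) _ s≤3 p = ≤∸⇒+≤ p s≤3

arrows₂ : Arrows 2 4
arrows₂ = arrows-direct 2 1 refl λ G o₀ o₁ pos s≤1 → bound (size G (allFin 4)) pos s≤1
  (hinted-untouched (1 ∸_) (∸-monoʳ-≤ 1) G [] 4 4 {allFin 4} zero refl refl [] refl)
  where
  bound : ∀ {u} s → 0 < s → s ≤ 1 → u ≤ 1 ∸ s → u + s ≤ 1
  bound s _ s≤1 p = ≤∸⇒+≤ p s≤1

HasBergeK-pred : ∀ {t n} (c : Colouring n) {col} → HasBergeK (suc t) n c col → HasBergeK t n c col
HasBergeK-pred c (φ , ψ , φ-inj , edges , distinct) =
  φ ∘ suc , (λ i j → ψ (suc i) (suc j)) , (λ e → Fin.suc-injective (φ-inj e)) , (λ i j p → edges (suc i) (suc j) (s≤s p)) ,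
  λ i j k l p q e → let a , b = distinct (suc i) (suc j) (suc k) (suc l) (s≤s p) (s≤s q) e in Fin.suc-injective a , Fin.suc-injective b

arrows₅ : Arrows 5 7
arrows₅ c = [ inj₁ ∘ HasBergeK-pred c , inj₂ ∘ HasBergeK-pred c ]′ (arrows-suc 6 ≤-refl c)

-- Lower bounds

subsets-complete : ∀ {n} (s : Subset n) → s ∈ subsets ∣ s ∣ n
subsets-complete []           = here refl
subsets-complete (inside ∷ s) = ∈-++⁺ˡ (∈-map⁺ (inside ∷_) (subsets-complete s))
subsets-complete {suc n} (outside ∷ s) with ∣ s ∣ | subsets-complete s
... | zero  | i = ∈-map⁺ (outside ∷_) i
... | suc k | i = ∈-++⁺ʳ (map (inside ∷_) (subsets k n)) (∈-map⁺ (outside ∷_) i)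

unique-map : ∀ {X Y : Set} (f : X → Y) {xs} → Unique xs → (∀ {x y} → x ∈ xs → y ∈ xs → f x ≡ f y → x ≡ y) → Unique (map f xs)
unique-map f [] h = []
unique-map f {x ∷ xs} (x∉ ∷ u) h =
  All.map⁺ (All.tabulate λ i e → lookup x∉ i (h (here refl) (there i) e)) ∷ unique-map f u λ i j → h (there i) (there j)

pairsOf-unique : {xs : List V} → Unique xs → Unique (pairsOf xs)
pairsOf-unique [] = []
pairsOf-unique {xs = x ∷ xs} (x∉ ∷ u) = ++⁺ (map⁺ (λ { refl → refl }) u) (pairsOf-unique u)
  λ (i , j) → case ∈-map⁻ (x ,_) i of λ { (_ , _ , refl) → lookup x∉ (proj₁ (∈-pairsOf j)) refl }

pairsOf-related : ∀ {R : V → V → Set} {xs} → AllPairs R xs → All (uncurry R) (pairsOf xs)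
pairsOf-related [] = []
pairsOf-related (r ∷ rs) = All.++⁺ (All.map⁺ r) (pairsOf-related rs)

length-pairsOf : ∀ (xs : List V) → length (pairsOf xs) ≡ tri (length xs)
length-pairsOf []       = refl
length-pairsOf (x ∷ xs) = ≡-trans (List.length-++ (map (x ,_) xs)) (cong₂ _+_ (List.length-map (x ,_) xs) (length-pairsOf xs))

length-filterᵇ : ∀ {X : Set} (p : X → Bool) xs → length (filterᵇ p xs) ≡ count p xs
length-filterᵇ p [] = refl
length-filterᵇ p (x ∷ xs) with p x
... | true  = cong suc (length-filterᵇ p xs)
... | false = length-filterᵇ p xs

berge⇒enough : ∀ {t n} (c : Colouring n) col → HasBergeK t n c col → tri t ≤ count (coloured c col) (subsets 4 n)
berge⇒enough {t} {n} c col (φ , ψ , φ-inj , edges , distinct) = begin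
  tri t                             ≡⟨ cong tri (length-allFin t) ⟨
  tri (length (allFin t))           ≡⟨ length-pairsOf (allFin t) ⟨
  length (pairsOf (allFin t))       ≡⟨ List.length-map (uncurry ψ) (pairsOf (allFin t)) ⟨
  length ψs                         ≤⟨ m≤m+n _ _ ⟩
  length ψs + length (proj₁ rest)   ≡⟨ List.length-++ ψs ⟨
  length (ψs ++ proj₁ rest)         ≡⟨ ↭-length (proj₂ rest) ⟨
  length (filterᵇ (coloured c col) (subsets 4 n)) ≡⟨ length-filterᵇ (coloured c col) (subsets 4 n) ⟩
  count (coloured c col) (subsets 4 n) ∎
  where
  open ≤-Reasoning
  ψs : List (Subset n)
  ψs = map (uncurry ψ) (pairsOf (allFin t))
  ordered : All (uncurry _<ᶠ_) (pairsOf (allFin t))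
  ordered = pairsOf-related (tabulate⁺-< λ p → p)
  unique-ψs : Unique ψs
  unique-ψs = unique-map (uncurry ψ) (pairsOf-unique (allFin⁺ t)) λ {(i , j)} {(k , l)} p q e →
    let a , b = distinct i j k l (lookup ordered p) (lookup ordered q) e in cong₂ _,_ a b
  included′ : ψs ⊆ filterᵇ (coloured c col) (subsets 4 n)
  included′ m with (i , j) , p , refl ← ∈-map⁻ (uncurry ψ) m with card , colour , _ ← edges i j (lookup ordered p) =
    ∈-filter⁺ (T? ∘ coloured c col) (subst (λ k → ψ i j ∈ subsets k n) card (subsets-complete (ψ i j)))
      (Equivalence.from T-≡ (dec-true (c (ψ i j) ≟ᵇ col) colour))
  rest = extract unique-ψs included′

-- The colouring by the pair 01

pairColouring : ∀ n → Colouring n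
pairColouring (suc (suc n)) (a ∷ b ∷ _) = a ∧ b
pairColouring _             _           = false

Scarce : ℕ → ℕ → Set
Scarce t n = count (coloured (pairColouring n) true) (subsets 4 n) < tri t
           × count (coloured (pairColouring n) false) (subsets 4 n) < tri t

scarce⇒¬arrows : ∀ {t n} → Scarce t n → ¬ Arrows t n
scarce⇒¬arrows {n = n} (a , b) arrows with arrows (pairColouring n)
... | inj₁ B = <⇒≱ a (berge⇒enough (pairColouring n) true B)
... | inj₂ B = <⇒≱ b (berge⇒enough (pairColouring n) false B)

scarce? : ∀ t n → Dec (Scarce t n)
scarce? t n = (_ <? _) ×-dec (_ <? _)

-- Both colour classes are counted by evaluation for every `n` below `t + 2`. For instance, on six
-- vertices they have 6 and 9 members, against the ten edges of K₅.
lower-small : ∀ t → 2 ≤ t → t ≤ 5 → ∀ {n} → n < t + 2 → ¬ Arrows t n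
lower-small 2 _ _ p = scarce⇒¬arrows (from-yes (allUpTo? (scarce? 2) 4) p)
lower-small 3 _ _ p = scarce⇒¬arrows (from-yes (allUpTo? (scarce? 3) 5) p)
lower-small 4 _ _ p = scarce⇒¬arrows (from-yes (allUpTo? (scarce? 4) 6) p)
lower-small 5 _ _ p = scarce⇒¬arrows (from-yes (allUpTo? (scarce? 5) 7) p)
lower-small 1 (s≤s ()) _ _
lower-small (suc (suc (suc (suc (suc (suc t)))))) _ (s≤s (s≤s (s≤s (s≤s (s≤s ()))))) _

count-none : ∀ {X : Set} (p : X → Bool) xs → (∀ x → p x ≡ false) → count p xs ≡ 0
count-none p []       h = refl
count-none p (x ∷ xs) h rewrite h x = count-none p xs h

count-pairColouring : ∀ m → count (coloured (pairColouring (2 + m)) true) (subsets 4 (2 + m)) ≡ tri m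
count-pairColouring m = begin
  count p (map (inside ∷_) (subsets 3 (suc m)) ++ map (outside ∷_) (subsets 4 (suc m)))
    ≡⟨ count-++ p (map (inside ∷_) (subsets 3 (suc m))) _ ⟩
  count p (map (inside ∷_) (subsets 3 (suc m))) + count p (map (outside ∷_) (subsets 4 (suc m)))
    ≡⟨ cong₂ _+_ (count-map p (inside ∷_) (subsets 3 (suc m))) (count-map p (outside ∷_) (subsets 4 (suc m))) ⟩
  count (p ∘ (inside ∷_)) (map (inside ∷_) (subsets 2 m) ++ map (outside ∷_) (subsets 3 m)) + count (p ∘ (outside ∷_)) (subsets 4 (suc m))
    ≡⟨ cong₂ _+_ (count-++ (p ∘ (inside ∷_)) (map (inside ∷_) (subsets 2 m)) _) (count-none _ (subsets 4 (suc m)) λ { (_ ∷ _) → refl }) ⟩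
  count (p ∘ (inside ∷_)) (map (inside ∷_) (subsets 2 m)) + count (p ∘ (inside ∷_)) (map (outside ∷_) (subsets 3 m)) + 0
    ≡⟨ +-identityʳ _ ⟩
  count (p ∘ (inside ∷_)) (map (inside ∷_) (subsets 2 m)) + count (p ∘ (inside ∷_)) (map (outside ∷_) (subsets 3 m))
    ≡⟨ cong₂ _+_ (count-map (p ∘ (inside ∷_)) (inside ∷_) (subsets 2 m)) (count-map (p ∘ (inside ∷_)) (outside ∷_) (subsets 3 m)) ⟩
  count (const true) (subsets 2 m) + count (const false) (subsets 3 m)
    ≡⟨ cong₂ _+_ (count-subsets 2 m (const true)) (count-none (const false) (subsets 3 m) λ _ → refl) ⟩
  ∑ 2 (const 1) (allFin m) + 0
    ≡⟨ +-identityʳ _ ⟩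
  ∑ 2 (const 1) (allFin m)
    ≡⟨ ∑₂-const (allFin m) ⟩
  tri (length (allFin m))
    ≡⟨ cong tri (length-allFin m) ⟩
  tri m ∎
  where
  open ≡-Reasoning
  p : Subset (2 + m) → Bool
  p = coloured (pairColouring (2 + m)) true

injective⇒surjective : ∀ {n} (φ : Fin n → Fin n) → Injective _≡_ _≡_ φ → ∀ y → ∃[ i ] φ i ≡ y
injective⇒surjective {n} φ φ-inj y with extract (tabulate⁺ φ-inj) (λ _ → ∈-allFin _)
... | ds , p with ∈-++⁻ (tabulate φ) (∈-resp-↭ p (∈-allFin y))
...   | inj₁ i = let k , e = ∈-tabulate⁻ i in k , sym e
...   | inj₂ i = ⊥-elim (no-rest ds ds≡0 i)
  where
  ds≡0 : length ds ≡ 0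
  ds≡0 = +-cancelˡ-≡ n _ _ (≡-trans (cong (_+ length ds) (sym (List.length-tabulate φ)))
    (≡-trans (sym (List.length-++ (tabulate φ))) (≡-trans (sym (↭-length p)) (≡-trans (length-allFin n) (sym (+-identityʳ n))))))
  no-rest : ∀ ds → length ds ≡ 0 → ¬ y ∈ ds
  no-rest [] _ ()

pairColouring-true : ∀ {m} s → zero ∈ˢ s → suc zero ∈ˢ s → pairColouring (2 + m) s ≢ false
pairColouring-true (_ ∷ _ ∷ _) here (there here) ()

¬arrows-self : ∀ m → ¬ Arrows (2 + m) (2 + m)
¬arrows-self m arrows with arrows (pairColouring (2 + m))
... | inj₁ B = <⇒≱ (≤-trans (s≤s (m≤n+m (tri m) m)) (s≤s (m≤n+m _ m)))
                 (≤-trans (berge⇒enough (pairColouring (2 + m)) true B) (≤-reflexive (count-pairColouring m)))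
-- On exactly `2 + m` points `φ` is onto, so some edge of the complete graph is sent to the pair 01
-- and its hyperedge would contain both.
... | inj₂ (φ , ψ , φ-inj , edges , _)
  with i , p ← injective⇒surjective φ φ-inj zero
  with j , q ← injective⇒surjective φ φ-inj (suc zero)
  with Fin.<-cmp i j
...   | tri< i<j _ _ = let _ , colour , a , b = edges i j i<j in
                       pairColouring-true (ψ i j) (subst (_∈ˢ ψ i j) p a) (subst (_∈ˢ ψ i j) q b) colour
...   | tri> _ _ j<i = let _ , colour , b , a = edges j i j<i in
                       pairColouring-true (ψ j i) (subst (_∈ˢ ψ j i) p a) (subst (_∈ˢ ψ j i) q b) colour
...   | tri≈ _ refl _ with () ← ≡-trans (sym p) q

lower-large : ∀ m {n} → n < 2 + m + 1 → ¬ Arrows (2 + m) n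
lower-large m {n} n< arrows with m≤n⇒m<n∨m≡n (s≤s⁻¹ (subst (n <_) (+-comm (2 + m) 1) n<))
... | inj₂ refl = ¬arrows-self m arrows
-- With fewer points than vertices there is no injection `φ`, so any colouring is a counterexample.
... | inj₁ n<t with arrows (const true)
...   | inj₁ (φ , _ , φ-inj , _) = <⇒≱ n<t (Fin.injective⇒≤ φ-inj)
...   | inj₂ (φ , _ , φ-inj , _) = <⇒≱ n<t (Fin.injective⇒≤ φ-inj)

theorem1p6 : (∀ (t : ℕ) → 2 ≤ t → t ≤ 5 → RamseyBK4≡ t (t + 2))
    × (∀ (t : ℕ) → 6 ≤ t → RamseyBK4≡ t (t + 1))
theorem1p6 = (λ t 2≤t t≤5 → upper-small t 2≤t t≤5 , λ M p → lower-small t 2≤t t≤5 p) ,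
             (λ t 6≤t → subst (Arrows t) (+-comm 1 t) (arrows-suc t 6≤t) , lower t 6≤t)
  where
  upper-small : ∀ t → 2 ≤ t → t ≤ 5 → Arrows t (t + 2)
  upper-small 2 _ _ = arrows₂
  upper-small 3 _ _ = arrows₃
  upper-small 4 _ _ = arrows₄
  upper-small 5 _ _ = arrows₅
  upper-small 1 (s≤s ()) _
  upper-small (suc (suc (suc (suc (suc (suc t)))))) _ (s≤s (s≤s (s≤s (s≤s (s≤s ())))))
  lower : ∀ t → 6 ≤ t → ∀ M → M < t + 1 → ¬ Arrows t M
  lower (suc (suc m)) _ M p = lower-large m p
  lower (suc zero) (s≤s ()) _ _
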